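{- For every $\varepsilon>0$ there is an integer $\ell_\varepsilon$ such that, with high probability (as $n\to\infty$), there is no graph homomorphism from $G\sim G\left(n,\frac{1+\varepsilon}{n}\right)$ to $C_{2\ell+1}$ for any $\ell\ge \ell_\varepsilon$. Moreover, one can take $\ell_\varepsilon = O\!\left(\frac{1}{\varepsilon^3}\right)$.
   Context: $G(n,p)$ is the binomial random graph on $n$ labeled vertices with each edge present independently with probability $p$. $C_r$ denotes the cycle on $r$ vertices. A graph homomorphism from $G$ to $G'$ is a map $\varphi:V(G)\to V(G')$ such that $\{\varphi(u),\varphi(v)\}\in E(G')$ whenever $\{u,v\}\in E(G)$.
   Formalization: The parameter ε ranges over positive rational numbers instead of positive reals, and the bound ℓ_ε = O(1/ε³) is stated as ℓ_ε·ε³ ≤ C for all ε ≤ 1 with one absolute constant C. -}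

module Defs where

open import Data.Bool using (Bool; true; false)
open import Data.Nat as ℕ using (ℕ; zero; suc; _%_; _<_; _≤_)
open import Data.Fin using (Fin; toℕ)
open import Data.Integer using (+_)
open import Data.Rational using (ℚ; 0ℚ; 1ℚ; _+_; _*_; _-_; _/_)
open import Data.List using (List; []; _∷_; _++_; map; concatMap; allFin; filter; foldr)
open import Data.Vec using (Vec; []; _∷_)
open import Data.Product using (Σ; _×_; _,_)
open import Data.Sum using (_⊎_)
open import Relation.Binary.PropositionalEquality using (_≡_)
open import Relation.Nullary using (Dec)

pairs : (n : ℕ) → List (Fin n × Fin n)
pairs n = concatMap (λ i → map (λ j → i , j)
                        (filter (λ j → toℕ i ℕ.<? toℕ j) (allFin n))) (allFin n)

numPairs : ℕ → ℕ
numPairs n = Data.List.length (pairs n)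

-- A (simple, labelled) graph on vertex set Fin n: one Bool per possible edge,
-- in the order of `pairs n` (true = edge present).
Graph : ℕ → Set
Graph n = Vec Bool (numPairs n)

edgeList : {n : ℕ} {k : ℕ} → List (Fin n × Fin n) → Vec Bool k → List (Fin n × Fin n)
edgeList []       _             = []
edgeList (_ ∷ _)  []            = []
edgeList (e ∷ es) (true  ∷ bs)  = e ∷ edgeList es bs
edgeList (e ∷ es) (false ∷ bs)  = edgeList es bs

edges : {n : ℕ} → Graph n → List (Fin n × Fin n)
edges {n} G = edgeList (pairs n) G

open import Data.List.Membership.Propositional using (_∈_)

Adj : {n : ℕ} → Graph n → Fin n → Fin n → Set
Adj G u v = ((u , v) ∈ edges G) ⊎ ((v , u) ∈ edges G)

CycAdj : (k : ℕ) → Fin k → Fin k → Set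
CycAdj k a b = Succ a b ⊎ Succ b a
  where
  Succ : Fin k → Fin k → Set
  Succ x y = (toℕ y ≡ suc (toℕ x)) ⊎ ((suc (toℕ x) ≡ k) × (toℕ y ≡ 0))

IsHom : {n : ℕ} (G : Graph n) (k : ℕ) → (Fin n → Fin k) → Set
IsHom {n} G k φ = ∀ (u v : Fin n) → Adj G u v → CycAdj k (φ u) (φ v)

HomToCycle : {n : ℕ} → Graph n → ℕ → Set
HomToCycle {n} G k = Σ (Fin n → Fin k) (IsHom G k)

allVecs : (m : ℕ) → List (Vec Bool m)
allVecs zero    = [] ∷ []
allVecs (suc m) = map (true ∷_) (allVecs m) ++ map (false ∷_) (allVecs m)

_^_ : ℚ → ℕ → ℚ
x ^ zero  = 1ℚ
x ^ suc k = x * (x ^ k)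

weight : {m : ℕ} → ℚ → Vec Bool m → ℚ
weight p []           = 1ℚ
weight p (true  ∷ bs) = p * weight p bs
weight p (false ∷ bs) = (1ℚ - p) * weight p bs

Prob : (n : ℕ) → ℚ → (Graph n → Bool) → ℚ
Prob n p S = foldr (λ G acc → indic (S G) G + acc) 0ℚ (allVecs (numPairs n))
  where
  indic : Bool → Graph n → ℚ
  indic true  G = weight p G
  indic false G = 0ℚ

-- edge probability (1+ε)/n of G(n,(1+ε)/n)  (n = 0 is irrelevant)
pGnp : ℕ → ℚ → ℚ
pGnp zero    ε = 0ℚ
pGnp (suc m) ε = (1ℚ + ε) * (+ 1 / suc m)

WHPNoHom : ℚ → ℕ → Set
WHPNoHom ε ℓ₀ =
  ∀ (δ : ℚ) → 0ℚ Data.Rational.< δ →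
  Σ ℕ λ N → ∀ (n : ℕ) → N ≤ n →
  Σ (Graph n → Bool) λ S →
    (∀ (G : Graph n) → (Σ ℕ λ ℓ → (ℓ₀ ≤ ℓ) × HomToCycle {n} G (suc (2 ℕ.* ℓ))) → S G ≡ true)
    × (Prob n (pGnp n ε) S Data.Rational.< δ)

{-# OPTIONS --safe #-}
-- Reveal G(n , p) in two rounds, G(n , p₁) and then a sprinkling G(n , p₂) with p₂ of order ε/n.
-- Exploring G(n , p₁) vertex by vertex, an exponential supermartingale shows that with high
-- probability some component contains a tree T on Θ(εn) vertices.  A homomorphism to a long odd
-- cycle provides many 2-colourings (cut the cycle at each of its edges in turn) such that every
-- edge is monochromatic in at most one of them, so by pigeonhole one of these colourings violates
-- few edges of T and few sprinkled edges inside T.  Up to the set of violated tree edges T has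
-- only two 2-colourings, each of which has Θ(ε²n²) monochromatic pairs and hence Θ(ε³n) expected
-- violated sprinkled edges; a weighted union bound over the colourings of T finishes the proof.
-- Every exponential estimate is an instance of Bernoulli's inequality.
module Submission where

open import Defs
open import Data.Bool using (Bool; true; false; _∨_; not; _xor_; if_then_else_)
open import Data.Fin using (Fin; zero; suc; toℕ)
import Data.Fin.Properties as Finₚ
open import Data.List as List using (List; []; _∷_; length; map; allFin; filter; foldr; _++_; concatMap)
open import Data.List.Membership.Propositional using (_∈_; _∉_)
open import Data.List.Relation.Unary.All as All using (All; []; _∷_)
open import Data.List.Relation.Unary.Any as Any using (here; there)
open import Data.Nat as ℕ using (ℕ; zero; suc; z≤n; s≤s)
import Data.Nat.Properties as ℕₚ
open import Data.Product using (Σ; ∃; _×_; _,_; proj₁; proj₂)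
open import Data.Sum using (_⊎_; inj₁; inj₂)
open import Data.Vec as Vec using (Vec; []; _∷_; zipWith; _[_]≔_)
import Data.Vec.Properties as Vecₚ
open import Function using (_∘_)
open import Relation.Binary using (Symmetric; tri<; tri≈; tri>)
open import Relation.Binary.PropositionalEquality
open import Relation.Nullary using (¬_; Dec; yes; no; contradiction; does)
open import Algebra.Properties.Semiring.Sum ℕₚ.+-*-semiring
  using (sum; ∑-distrib-+; ∑-comm; sum-cong-≗; *-distribˡ-sum; *-distribʳ-sum)

-- The obstacle is entropy. A tree on `s` vertices has `2 ^ s` colourings, while a fixed one
-- survives the sprinkling with probability about `exp(- K c² s)`, where `c` is of order ε and `K` a
-- constant, so a plain union bound fails. Connectedness repairs this: a colouring is a root colour
-- together with a set of violated tree edges, and with about `c ^ -3` cuts to choose from, only a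
-- tiny fraction of the edges is violated. Weights replace the counting of such sets: charging
-- `y = c²` per violation turns `2 ^ s` into `2 (1 + y) ^ s`, and the compensating charge
-- `u = 1 + c²` per edge costs a factor of the same size. Both are beaten by the sprinkling, which
-- gains a larger multiple of c² per tree vertex. A second constraint is that one Boolean event has
-- to cover all `ℓ ≥ ℓ₀` simultaneously. `separable` mentions no cycle: it asks for `2 ℓ₀`
-- colourings, and every admissible cycle supplies at least that many cuts.

module Graphs where

  open import Data.Bool using (T)
  open import Data.List.Membership.Propositional.Properties using (∈-map⁺; ∈-filter⁺; ∈-concat⁺′; ∈-allFin)
  open import Data.List.Relation.Unary.Any.Properties using (lookup-index)
  open import Data.Nat using (_≤_; _<_; _≤ᵇ_; _+_; _*_)
  open import Data.Nat.Properties
  open import Relation.Nullary.Decidable using (map′)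

  -- Graphs as bit vectors

  Slot : ∀ {n} → Fin n → Fin n → Fin (numPairs n) → Set
  Slot {n} u v i = (List.lookup (pairs n) i ≡ (u , v)) ⊎ (List.lookup (pairs n) i ≡ (v , u))

  Slot-sym : ∀ {n} {u v : Fin n} {i} → Slot u v i → Slot v u i
  Slot-sym (inj₁ eq) = inj₂ eq
  Slot-sym (inj₂ eq) = inj₁ eq

  Slot-unique : ∀ {n} {a b u v : Fin n} {i} → Slot a b i → Slot u v i → (a ≡ u × b ≡ v) ⊎ (a ≡ v × b ≡ u)
  Slot-unique (inj₁ p) (inj₁ q) with refl ← trans (sym p) q = inj₁ (refl , refl)
  Slot-unique (inj₁ p) (inj₂ q) with refl ← trans (sym p) q = inj₂ (refl , refl)
  Slot-unique (inj₂ p) (inj₁ q) with refl ← trans (sym p) q = inj₂ (refl , refl)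
  Slot-unique (inj₂ p) (inj₂ q) with refl ← trans (sym p) q = inj₁ (refl , refl)

  ∈-pairs : ∀ {n} {i j : Fin n} → toℕ i < toℕ j → (i , j) ∈ pairs n
  ∈-pairs {n} {i} {j} i<j = ∈-concat⁺′
    (∈-map⁺ (i ,_) (∈-filter⁺ (λ j → toℕ i ℕ.<? toℕ j) (∈-allFin j) i<j))
    (∈-map⁺ (λ i → map (λ j → i , j) (filter (λ j → toℕ i ℕ.<? toℕ j) (allFin n))) (∈-allFin i))

  slot : ∀ {n} {u v : Fin n} → u ≢ v → ∃ (Slot u v)
  slot {u = u} {v} u≢v with <-cmp (toℕ u) (toℕ v)
  ... | tri< u<v _ _ = Any.index (∈-pairs u<v) , inj₁ (sym (lookup-index (∈-pairs u<v)))
  ... | tri≈ _ u≡v _ = contradiction (Finₚ.toℕ-injective u≡v) u≢v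
  ... | tri> _ _ v<u = Any.index (∈-pairs v<u) , inj₂ (sym (lookup-index (∈-pairs v<u)))

  -- Adjacency read off a single bit instead of the edge list, so that overwriting bits, which is
  -- how edges are exposed later, acts on it directly.
  Joined : ∀ {n} → Fin n → Fin n → Graph n → Set
  Joined u v G = ∃ λ i → Slot u v i × Vec.lookup G i ≡ true

  lookup-edgeList : ∀ {n} (es : List (Fin n × Fin n)) (bs : Vec Bool (length es)) i →
    Vec.lookup bs i ≡ true → List.lookup es i ∈ edgeList {n} es bs
  lookup-edgeList (e ∷ es) (true  ∷ bs) zero    eq = here refl
  lookup-edgeList (e ∷ es) (true  ∷ bs) (suc i) eq = there (lookup-edgeList es bs i eq)
  lookup-edgeList (e ∷ es) (false ∷ bs) (suc i) eq = lookup-edgeList es bs i eq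

  Joined⇒Adj : ∀ {n} {u v : Fin n} {G : Graph n} → Joined u v G → Adj {n} G u v
  Joined⇒Adj {n} {G = G} (i , inj₁ p , eq) = inj₁ (subst (_∈ edges {n} G) p (lookup-edgeList (pairs n) G i eq))
  Joined⇒Adj {n} {G = G} (i , inj₂ p , eq) = inj₂ (subst (_∈ edges {n} G) p (lookup-edgeList (pairs n) G i eq))

  Joined-∨ˡ : ∀ {n} {u v : Fin n} (G H : Graph n) → Joined u v G → Joined u v (zipWith _∨_ G H)
  Joined-∨ˡ G H (i , s , eq) = i , s , trans (Vecₚ.lookup-zipWith _∨_ i G H) (cong (_∨ Vec.lookup H i) eq)

  All-edgeList-∨ʳ : ∀ {n} {P : Fin n × Fin n → Set} es (bs cs : Vec Bool (length es)) →
    All P (edgeList {n} es (zipWith _∨_ bs cs)) → All P (edgeList {n} es cs)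
  All-edgeList-∨ʳ []       bs           cs           ps       = []
  All-edgeList-∨ʳ (e ∷ es) (true ∷ bs)  (true ∷ cs)  (p ∷ ps) = p ∷ All-edgeList-∨ʳ es bs cs ps
  All-edgeList-∨ʳ (e ∷ es) (false ∷ bs) (true ∷ cs)  (p ∷ ps) = p ∷ All-edgeList-∨ʳ es bs cs ps
  All-edgeList-∨ʳ (e ∷ es) (true ∷ bs)  (false ∷ cs) (p ∷ ps) = All-edgeList-∨ʳ es bs cs ps
  All-edgeList-∨ʳ (e ∷ es) (false ∷ bs) (false ∷ cs) ps       = All-edgeList-∨ʳ es bs cs ps

  -- Families of 2-colourings and the cuts of an odd cycle

  same : Bool → Bool → ℕ
  same true  true  = 1
  same false false = 1
  same true  false = 0
  same false true  = 0

  same-sym : ∀ a b → same a b ≡ same b a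
  same-sym true  true  = refl
  same-sym true  false = refl
  same-sym false true  = refl
  same-sym false false = refl

  same≤1 : ∀ a b → same a b ≤ 1
  same≤1 true  true  = ≤-refl
  same≤1 true  false = z≤n
  same≤1 false true  = z≤n
  same≤1 false false = ≤-refl

  same-≢ : ∀ {a b} → a ≢ b → same a b ≡ 0
  same-≢ {true}  {true}  a≢b = contradiction refl a≢b
  same-≢ {true}  {false} a≢b = refl
  same-≢ {false} {true}  a≢b = refl
  same-≢ {false} {false} a≢b = contradiction refl a≢b

  Family : ℕ → ℕ → Set
  Family k n = Fin k → Fin n → Bool

  monochromatic : ∀ {k n} → Family k n → Fin n × Fin n → ℕ
  monochromatic σ (u , v) = sum (λ c → same (σ c u) (σ c v))

  monochromatic-cong : ∀ {k n} {σ τ : Family k n} → (∀ c v → σ c v ≡ τ c v) → ∀ e → monochromatic σ e ≡ monochromatic τ e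
  monochromatic-cong eq (u , v) = sum-cong-≗ (λ c → cong₂ same (eq c u) (eq c v))

  -- The trace that a homomorphism to a long odd cycle leaves on the graph. Being a condition on
  -- single edges, it passes to the tree and to the sprinkled edges separately.
  Separated : ∀ {k n} → Family k n → Graph n → Set
  Separated {n = n} σ G = All (λ e → monochromatic σ e ≤ 1) (edges {n} G)

  Separated-Adj : ∀ {k n} {σ : Family k n} {G : Graph n} → Separated σ G → ∀ {u v : Fin n} → Adj {n} G u v → monochromatic σ (u , v) ≤ 1
  Separated-Adj sep (inj₁ uv∈) = All.lookup sep uv∈
  Separated-Adj {σ = σ} sep {u} {v} (inj₂ vu∈) = subst (_≤ 1)
    (sum-cong-≗ (λ c → same-sym (σ c v) (σ c u))) (All.lookup sep vu∈)

  parity : ℕ → Bool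
  parity zero    = false
  parity (suc k) = not (parity k)

  parity-2* : ∀ k → parity (2 * k) ≡ false
  parity-2* zero    = refl
  parity-2* (suc k) rewrite +-suc k (k + 0) | parity-2* k = refl

  -- Alternating 2-colouring of the path obtained from an odd cycle by deleting the edge that leaves position c.
  cut : ℕ → ℕ → Bool
  cut c x = parity x xor (x ≤ᵇ c)

  ≤ᵇ-true : ∀ {m n} → m ≤ n → (m ≤ᵇ n) ≡ true
  ≤ᵇ-true {m} {n} m≤n with m ≤ᵇ n in eq
  ... | true  = refl
  ... | false = contradiction (subst T eq (≤⇒≤ᵇ m≤n)) λ ()

  ≤ᵇ-false : ∀ {m n} → n < m → (m ≤ᵇ n) ≡ false
  ≤ᵇ-false {m} {n} n<m with m ≤ᵇ n in eq
  ... | false = refl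
  ... | true  = contradiction (≤ᵇ⇒≤ m n (subst T (sym eq) _)) (<⇒≱ n<m)

  cut-suc : ∀ c x → c ≢ x → cut c x ≢ cut c (suc x)
  cut-suc c x c≢x with <-cmp c x
  ... | tri< c<x _ _ rewrite ≤ᵇ-false c<x | ≤ᵇ-false (m<n⇒m<1+n c<x) = lem (parity x)
    where
    lem : ∀ a → a xor false ≢ not a xor false
    lem true ()
    lem false ()
  ... | tri≈ _ c≡x _ = contradiction c≡x c≢x
  ... | tri> _ _ x<c rewrite ≤ᵇ-true (<⇒≤ x<c) | ≤ᵇ-true x<c = lem (parity x)
    where
    lem : ∀ a → a xor true ≢ not a xor true
    lem true ()
    lem false ()

  -- The closing edge joins positions `2 * ℓ` and `0`, both of even parity; they get different
  -- colours because only `0` lies at or before `c`. This is where the odd length of the cycle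
  -- enters.
  cut-wrap : ∀ c ℓ → c < 2 * ℓ → cut c (2 * ℓ) ≢ cut c 0
  cut-wrap c ℓ c<2ℓ rewrite parity-2* ℓ | ≤ᵇ-false c<2ℓ = λ ()

  sum-zero : ∀ {k} (f : Fin k → ℕ) → (∀ c → f c ≡ 0) → sum f ≡ 0
  sum-zero {zero}  f f≡0 = refl
  sum-zero {suc k} f f≡0 = cong₂ _+_ (f≡0 zero) (sum-zero (f ∘ suc) (f≡0 ∘ suc))

  sum-concentrated : ∀ {k} (f : Fin k → ℕ) m → (∀ c → f c ≤ 1) → (∀ c → toℕ c ≢ m → f c ≡ 0) → sum f ≤ 1
  sum-concentrated {zero}  f m       f≤1 f≡0 = z≤n
  sum-concentrated {suc k} f zero    f≤1 f≡0
    rewrite sum-zero (f ∘ suc) (λ c → f≡0 (suc c) λ ()) | +-identityʳ (f zero) = f≤1 zero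
  sum-concentrated {suc k} f (suc m) f≤1 f≡0
    rewrite f≡0 zero (λ ()) = sum-concentrated (f ∘ suc) m (f≤1 ∘ suc) (λ c c≢m → f≡0 (suc c) (c≢m ∘ suc-injective))

  cutFamily : ∀ {n K} k → (Fin n → Fin K) → Family k n
  cutFamily k φ c v = cut (toℕ c) (toℕ (φ v))

  -- An edge of `G` lands on one edge of the cycle, and only the cut at that very edge makes it
  -- monochromatic. The cut at the closing edge is left out, hence `2 * ℓ` cuts from `2 * ℓ + 1`
  -- edges.
  HomToCycle⇒Separated : ∀ {n k ℓ} {G : Graph n} → k ≤ 2 * ℓ → (h : HomToCycle {n} G (suc (2 * ℓ))) →
    Separated (cutFamily k (proj₁ h)) G
  HomToCycle⇒Separated {n} {k} {ℓ} {G} k≤2ℓ (φ , hom) = All.tabulate λ {e} e∈ → edge (hom _ _ (inj₁ e∈))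
    where
    σ = cutFamily k φ
    step : ∀ u v → (toℕ (φ v) ≡ suc (toℕ (φ u))) ⊎ ((suc (toℕ (φ u)) ≡ suc (2 * ℓ)) × (toℕ (φ v) ≡ 0)) →
           monochromatic σ (u , v) ≤ 1
    step u v s = sum-concentrated _ (toℕ (φ u)) (λ c → same≤1 (σ c u) (σ c v)) (λ c c≢ → same-≢ (differ c c≢ s))
      where
      differ : ∀ c → toℕ c ≢ toℕ (φ u) → _ → σ c u ≢ σ c v
      differ c c≢ (inj₁ eq) = subst (λ y → cut (toℕ c) (toℕ (φ u)) ≢ cut (toℕ c) y) (sym eq)
        (cut-suc (toℕ c) (toℕ (φ u)) c≢)
      differ c c≢ (inj₂ (eq , eq′)) = subst₂ (λ x y → cut (toℕ c) x ≢ cut (toℕ c) y)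
        (sym (suc-injective eq)) (sym eq′) (cut-wrap (toℕ c) ℓ (<-≤-trans (Finₚ.toℕ<n c) k≤2ℓ))
    edge : ∀ {e} → CycAdj (suc (2 * ℓ)) (φ (proj₁ e)) (φ (proj₂ e)) → monochromatic σ e ≤ 1
    edge {u , v} (inj₁ s) = step u v s
    edge {u , v} (inj₂ s) = subst (_≤ 1) (sum-cong-≗ (λ c → same-sym (σ c v) (σ c u))) (step v u s)

  -- Deciding separability by finite search

  Searchable : Set → Set₁
  Searchable A = (P : A → Set) → (∀ a → Dec (P a)) → Dec (∃ P)

  Bool-searchable : Searchable Bool
  Bool-searchable P P? with P? true | P? false
  ... | yes p | _     = yes (true , p)
  ... | no _  | yes p = yes (false , p)
  ... | no ¬t | no ¬f = no λ where
    (true  , p) → ¬t p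
    (false , p) → ¬f p

  Vec-searchable : ∀ {A} m → Searchable A → Searchable (Vec A m)
  Vec-searchable zero    srch P P? = map′ ([] ,_) (λ where ([] , p) → p) (P? [])
  Vec-searchable (suc m) srch P P? = map′ (λ (a , v , p) → a ∷ v , p) (λ where (a ∷ v , p) → a , v , p)
    (srch _ λ a → Vec-searchable m srch _ λ v → P? (a ∷ v))

  lookupFamily : ∀ {k n} → Vec (Vec Bool n) k → Family k n
  lookupFamily σ c v = Vec.lookup (Vec.lookup σ c) v

  separable? : ∀ k n (G : Graph n) → Dec (∃ λ σ → Separated (lookupFamily {k} σ) G)
  separable? k n G = Vec-searchable k (Vec-searchable n Bool-searchable) _
    (λ σ → All.all? (λ e → monochromatic (lookupFamily σ) e ≤? 1) (edges {n} G))

  separable : ∀ k n → Graph n → Bool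
  separable k n G = does (separable? k n G)

  Separated⇒separable : ∀ {k n} {σ : Family k n} {G : Graph n} → Separated σ G → separable k n G ≡ true
  Separated⇒separable {k} {n} {σ} {G} sep with separable? k n G
  ... | yes _ = refl
  ... | no ¬s = contradiction (τ , All.map (λ {e} → subst (_≤ 1) (monochromatic-cong τ≡σ e)) sep) ¬s
    where
    τ = Vec.tabulate (λ c → Vec.tabulate (σ c))
    τ≡σ : ∀ c v → σ c v ≡ lookupFamily τ c v
    τ≡σ c v = sym (trans (cong (λ w → Vec.lookup w v) (Vecₚ.lookup∘tabulate (λ c → Vec.tabulate (σ c)) c))
                         (Vecₚ.lookup∘tabulate (σ c) v))

  separable⇒Separated : ∀ k n {G : Graph n} → separable k n G ≡ true → ∃ λ (σ : Family k n) → Separated σ G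
  separable⇒Separated k n {G} eq with separable? k n G
  ... | yes (σ , sep) = lookupFamily σ , sep

  pigeonhole : ∀ {k} (f : Fin (suc k) → ℕ) → ∃ λ c → suc k * f c ≤ sum f
  pigeonhole {zero}  f = zero , ≤-refl
  pigeonhole {suc k} f with pigeonhole (f ∘ suc)
  ... | c , p with ≤-total (f zero) (f (suc c))
  ...   | inj₁ q = zero , +-monoʳ-≤ (f zero) (≤-trans (*-monoʳ-≤ (suc k) q) p)
  ...   | inj₂ q = suc c , +-mono-≤ q p

module Development where

  open Graphs
  open import Data.Integer as ℤ using (+_)
  import Data.List.Properties as Listₚ
  open import Data.List.Relation.Binary.Permutation.Propositional as Perm using (_↭_; ↭-sym)
  open import Data.List.Relation.Binary.Permutation.Propositional.Properties using (shift; ++⁺ˡ; All-resp-↭)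
  import Data.List.Relation.Unary.All.Properties as Allₚ
  open import Data.List.Relation.Unary.AllPairs as AllPairs using (AllPairs; []; _∷_)
  import Data.List.Relation.Unary.Unique.Propositional.Properties as Uniqueₚ
  open import Data.Maybe using (Maybe; just; nothing)
  import Data.Nat.DivMod as DivMod
  open import Data.Nat.Tactic.RingSolver using () renaming (solve-∀ to ℕ-solve-∀)
  open import Data.Rational as ℚ using (ℚ; 0ℚ; 1ℚ; _+_; _*_; _-_; -_; _/_; _≤_; _<_; mkℚ)
  open import Data.Rational.Properties
  open import Level using (0ℓ)
  open import Relation.Nullary.Decidable using (dec⇒maybe; dec-true; dec-false)
  open import Tactic.RingSolver using (solve-∀)
  open import Tactic.RingSolver.Core.AlmostCommutativeRing using (AlmostCommutativeRing; fromCommutativeRing)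

  -- Rational arithmetic, casts, powers and Bernoulli's inequality

  ℚ-ring : AlmostCommutativeRing 0ℓ 0ℓ
  ℚ-ring = fromCommutativeRing +-*-commutativeRing (λ x → dec⇒maybe (0ℚ ≟ x))

  -- The form in which polynomial inequalities are certified: the difference is written as a visibly
  -- nonnegative expression, and the identity is left to the ring solver.
  ≤-by : ∀ {p q} d → 0ℚ ≤ d → p + d ≡ q → p ≤ q
  ≤-by {p} d 0≤d refl = subst (_≤ p + d) (+-identityʳ p) (+-monoʳ-≤ p 0≤d)

  gap : ∀ {p q} → p ≤ q → 0ℚ ≤ q - p
  gap {p} {q} p≤q = subst (_≤ q - p) (+-inverseʳ p) (+-monoˡ-≤ (- p) p≤q)

  *-mono : ∀ {p q r s} → 0ℚ ≤ p → 0ℚ ≤ s → p ≤ q → r ≤ s → p * r ≤ q * s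
  *-mono {p} {q} {r} {s} 0≤p 0≤s p≤q r≤s =
    ≤-trans (*-monoˡ-≤-nonNeg p {{ℚ.nonNegative 0≤p}} r≤s) (*-monoʳ-≤-nonNeg s {{ℚ.nonNegative 0≤s}} p≤q)

  *-monoʳ : ∀ {p q r} → 0ℚ ≤ r → p ≤ q → r * p ≤ r * q
  *-monoʳ {r = r} 0≤r = *-monoˡ-≤-nonNeg r {{ℚ.nonNegative 0≤r}}

  *-monoˡ : ∀ {p q r} → 0ℚ ≤ r → p ≤ q → p * r ≤ q * r
  *-monoˡ {r = r} 0≤r = *-monoʳ-≤-nonNeg r {{ℚ.nonNegative 0≤r}}

  *-nonneg : ∀ {p q} → 0ℚ ≤ p → 0ℚ ≤ q → 0ℚ ≤ p * q
  *-nonneg {p} {q} 0≤p 0≤q = subst (_≤ p * q) (*-zeroʳ p) (*-monoʳ 0≤p 0≤q)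

  +-nonneg : ∀ {p q} → 0ℚ ≤ p → 0ℚ ≤ q → 0ℚ ≤ p + q
  +-nonneg = +-mono-≤

  0≤1 : 0ℚ ≤ 1ℚ
  0≤1 = ℚ.*≤* (ℤ.+≤+ ℕ.z≤n)

  0<1 : 0ℚ < 1ℚ
  0<1 = ℚ.*<* (ℤ.+<+ (ℕ.s≤s ℕ.z≤n))

  *-cancel : ∀ {p q r} → 0ℚ < r → r * p ≤ r * q → p ≤ q
  *-cancel {r = r} 0<r = *-cancelˡ-≤-pos r {{ℚ.positive 0<r}}

  -- A cast defined by recursion, since `+ k / 1` normalises a fraction and does not unfold along an
  -- induction on `k`.
  ⟦_⟧ : ℕ → ℚ
  ⟦ zero ⟧  = 0ℚ
  ⟦ suc k ⟧ = 1ℚ + ⟦ k ⟧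

  ⟦⟧-nonneg : ∀ k → 0ℚ ≤ ⟦ k ⟧
  ⟦⟧-nonneg zero    = ≤-refl
  ⟦⟧-nonneg (suc k) = +-nonneg 0≤1 (⟦⟧-nonneg k)

  ⟦⟧-pos : ∀ k → 0ℚ < ⟦ suc k ⟧
  ⟦⟧-pos k = <-≤-trans 0<1 (≤-by {1ℚ} ⟦ k ⟧ (⟦⟧-nonneg k) refl)

  ⟦⟧-+ : ∀ j k → ⟦ j ℕ.+ k ⟧ ≡ ⟦ j ⟧ + ⟦ k ⟧
  ⟦⟧-+ zero    k = sym (+-identityˡ ⟦ k ⟧)
  ⟦⟧-+ (suc j) k = trans (cong (_+_ 1ℚ) (⟦⟧-+ j k)) (sym (+-assoc 1ℚ ⟦ j ⟧ ⟦ k ⟧))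

  ⟦⟧-* : ∀ j k → ⟦ j ℕ.* k ⟧ ≡ ⟦ j ⟧ * ⟦ k ⟧
  ⟦⟧-* zero    k = sym (*-zeroˡ ⟦ k ⟧)
  ⟦⟧-* (suc j) k = trans (⟦⟧-+ k (j ℕ.* k)) (trans (cong (_+_ ⟦ k ⟧) (⟦⟧-* j k)) (lem ⟦ j ⟧ ⟦ k ⟧))
    where
    lem : ∀ a b → b + a * b ≡ (1ℚ + a) * b
    lem = solve-∀ ℚ-ring

  ⟦⟧-mono : ∀ {j k} → j ℕ.≤ k → ⟦ j ⟧ ≤ ⟦ k ⟧
  ⟦⟧-mono {k = k} ℕ.z≤n = ⟦⟧-nonneg k
  ⟦⟧-mono (ℕ.s≤s j≤k)   = +-monoʳ-≤ 1ℚ (⟦⟧-mono j≤k)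

  /1-suc : ∀ k → + suc k / 1 ≡ 1ℚ + + k / 1
  /1-suc k = toℚᵘ-injective (ℚᵘₚ.≃-trans (toℚᵘ-fromℚᵘ (mkℚᵘ (+ suc k) 0))
      (ℚᵘₚ.≃-trans (*≡* eq) (ℚᵘₚ.≃-sym (ℚᵘₚ.≃-trans (toℚᵘ-homo-+ 1ℚ (+ k / 1))
        (ℚᵘₚ.+-cong {toℚᵘ 1ℚ} ℚᵘₚ.≃-refl (toℚᵘ-fromℚᵘ (mkℚᵘ (+ k) 0)))))))
    where
    open import Data.Rational.Unnormalised using (mkℚᵘ; *≡*)
    open import Data.Rational using (toℚᵘ)
    import Data.Rational.Unnormalised.Properties as ℚᵘₚ
    import Data.Integer.Properties as ℤₚ
    eq : + suc k ℤ.* + 1 ≡ (+ 1 ℤ.* + 1 ℤ.+ + k ℤ.* + 1) ℤ.* + 1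
    eq rewrite ℤₚ.*-identityʳ (+ k) = refl

  /1≡⟦⟧ : ∀ k → + k / 1 ≡ ⟦ k ⟧
  /1≡⟦⟧ zero    = refl
  /1≡⟦⟧ (suc k) = trans (/1-suc k) (cong (_+_ 1ℚ) (/1≡⟦⟧ k))

  1/-inverse : ∀ k → ⟦ suc k ⟧ * (+ 1 / suc k) ≡ 1ℚ
  1/-inverse k = trans (cong (_* (+ 1 / suc k)) (sym (/1≡⟦⟧ (suc k))))
    (toℚᵘ-injective (ℚᵘₚ.≃-trans (toℚᵘ-homo-* (+ suc k / 1) (+ 1 / suc k))
      (ℚᵘₚ.≃-trans (ℚᵘₚ.*-cong (toℚᵘ-fromℚᵘ (mkℚᵘ (+ suc k) 0)) (toℚᵘ-fromℚᵘ (mkℚᵘ (+ 1) k)))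
        (*≡* eq))))
    where
    open import Data.Rational.Unnormalised using (mkℚᵘ; *≡*)
    import Data.Rational.Unnormalised.Properties as ℚᵘₚ
    import Data.Integer.Properties as ℤₚ
    eq : (+ suc k ℤ.* + 1) ℤ.* + 1 ≡ + 1 ℤ.* (+ 1 ℤ.* + suc k)
    eq = trans (ℤₚ.*-identityʳ (+ suc k ℤ.* + 1)) (trans (ℤₚ.*-comm (+ suc k) (+ 1)) (sym (ℤₚ.*-identityˡ (+ 1 ℤ.* + suc k))))

  -- A positive fraction is at least one over its denominator, so the denominator is a witness.
  archimedean : ∀ p → 0ℚ < p → Σ ℕ λ k → 1ℚ ≤ ⟦ k ⟧ * p
  archimedean p@(mkℚ (+ suc a) b _) 0<p = suc b , subst₂ _≤_ (1/-inverse b) refl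
    (*-monoʳ (⟦⟧-nonneg (suc b)) (toℚᵘ-cancel-≤ (ℚᵘₚ.≤-respˡ-≃ (ℚᵘₚ.≃-sym (toℚᵘ-fromℚᵘ (mkℚᵘ (+ 1) b)))
      (*≤* (ℤₚ.*-monoʳ-≤-nonNeg (+ suc b) {+ 1} {+ suc a} (ℤ.+≤+ (ℕ.s≤s ℕ.z≤n)))))))
    where
    open import Data.Rational.Unnormalised using (mkℚᵘ; *≤*)
    import Data.Rational.Unnormalised.Properties as ℚᵘₚ
    import Data.Integer.Properties as ℤₚ
  archimedean (mkℚ (+ zero) b _) (ℚ.*<* (ℤ.+<+ ()))
  archimedean (mkℚ ℤ.-[1+ a ] b _) (ℚ.*<* ())

  archimedean-≥ : ∀ p K → 0ℚ < p → Σ ℕ λ k → ⟦ K ⟧ ≤ ⟦ k ⟧ * p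
  archimedean-≥ p K 0<p with archimedean p 0<p
  ... | k , 1≤kp = K ℕ.* k , subst₂ _≤_ (*-identityʳ ⟦ K ⟧)
    (trans (sym (*-assoc ⟦ K ⟧ ⟦ k ⟧ p)) (cong (_* p) (sym (⟦⟧-* K k))))
    (*-monoʳ (⟦⟧-nonneg K) 1≤kp)

  ^-nonneg : ∀ {x} k → 0ℚ ≤ x → 0ℚ ≤ x ^ k
  ^-nonneg zero    0≤x = 0≤1
  ^-nonneg (suc k) 0≤x = *-nonneg 0≤x (^-nonneg k 0≤x)

  ^-monoˡ : ∀ {x y} k → 0ℚ ≤ x → x ≤ y → x ^ k ≤ y ^ k
  ^-monoˡ zero    0≤x x≤y = ≤-refl
  ^-monoˡ (suc k) 0≤x x≤y = *-mono 0≤x (^-nonneg k (≤-trans 0≤x x≤y)) x≤y (^-monoˡ k 0≤x x≤y)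

  1^ : ∀ k → 1ℚ ^ k ≡ 1ℚ
  1^ zero    = refl
  1^ (suc k) = trans (*-identityˡ _) (1^ k)

  ^-≥1 : ∀ {x} k → 1ℚ ≤ x → 1ℚ ≤ x ^ k
  ^-≥1 {x} k 1≤x = subst (_≤ x ^ k) (1^ k) (^-monoˡ k 0≤1 1≤x)

  ^-≤1 : ∀ {x} k → 0ℚ ≤ x → x ≤ 1ℚ → x ^ k ≤ 1ℚ
  ^-≤1 {x} k 0≤x x≤1 = subst (x ^ k ≤_) (1^ k) (^-monoˡ k 0≤x x≤1)

  ^-+ : ∀ x j k → x ^ (j ℕ.+ k) ≡ x ^ j * x ^ k
  ^-+ x zero    k = sym (*-identityˡ _)
  ^-+ x (suc j) k = trans (cong (x *_) (^-+ x j k)) (sym (*-assoc x _ _))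

  ^-* : ∀ x j k → x ^ (j ℕ.* k) ≡ (x ^ k) ^ j
  ^-* x zero    k = refl
  ^-* x (suc j) k = trans (^-+ x k (j ℕ.* k)) (cong (x ^ k *_) (^-* x j k))

  ^-distrib-* : ∀ x y k → (x * y) ^ k ≡ x ^ k * y ^ k
  ^-distrib-* x y zero    = refl
  ^-distrib-* x y (suc k) = trans (cong (x * y *_) (^-distrib-* x y k)) (lem x y (x ^ k) (y ^ k))
    where
    lem : ∀ a b c d → a * b * (c * d) ≡ a * c * (b * d)
    lem = solve-∀ ℚ-ring

  ^-monoʳ : ∀ {x j k} → 1ℚ ≤ x → j ℕ.≤ k → x ^ j ≤ x ^ k
  ^-monoʳ {k = k} 1≤x ℕ.z≤n = ^-≥1 k 1≤x
  ^-monoʳ 1≤x (ℕ.s≤s j≤k) = *-monoʳ (≤-trans 0≤1 1≤x) (^-monoʳ 1≤x j≤k)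

  ^-antiʳ : ∀ {x j k} → 0ℚ ≤ x → x ≤ 1ℚ → j ℕ.≤ k → x ^ k ≤ x ^ j
  ^-antiʳ {k = k} 0≤x x≤1 ℕ.z≤n = ^-≤1 k 0≤x x≤1
  ^-antiʳ 0≤x x≤1 (ℕ.s≤s j≤k) = *-monoʳ 0≤x (^-antiʳ 0≤x x≤1 j≤k)

  bernoulli : ∀ {x} k → 0ℚ ≤ x → 1ℚ + ⟦ k ⟧ * x ≤ (1ℚ + x) ^ k
  bernoulli {x} zero    0≤x = ≤-reflexive (trans (cong (_+_ 1ℚ) (*-zeroˡ x)) (+-identityʳ 1ℚ))
  bernoulli {x} (suc k) 0≤x = ≤-trans
    (≤-by (⟦ k ⟧ * (x * x)) (*-nonneg (⟦⟧-nonneg k) (*-nonneg 0≤x 0≤x)) (lem x ⟦ k ⟧))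
    (*-monoʳ (+-nonneg 0≤1 0≤x) (bernoulli k 0≤x))
    where
    lem : ∀ x k → 1ℚ + (1ℚ + k) * x + k * (x * x) ≡ (1ℚ + x) * (1ℚ + k * x)
    lem = solve-∀ ℚ-ring

  -- Plays the role of `(1 - x) ^ k ≤ exp(- k x)`, in a form free of division. In the induction
  -- `(1 - x)(1 + (k + 1) x)` falls short of `1 + k x` by `(k + 1) x²`.
  bernoulli-decay : ∀ {x} k → 0ℚ ≤ x → x ≤ 1ℚ → (1ℚ - x) ^ k * (1ℚ + ⟦ k ⟧ * x) ≤ 1ℚ
  bernoulli-decay {x} zero    0≤x x≤1 = ≤-reflexive (lem x)
    where
    lem : ∀ x → 1ℚ * (1ℚ + 0ℚ * x) ≡ 1ℚ
    lem = solve-∀ ℚ-ring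
  bernoulli-decay {x} (suc k) 0≤x x≤1 = ≤-trans
    (≤-by ((1ℚ - x) ^ k * ((1ℚ + ⟦ k ⟧) * (x * x)))
          (*-nonneg (^-nonneg k (gap x≤1)) (*-nonneg (⟦⟧-nonneg (suc k)) (*-nonneg 0≤x 0≤x)))
          (lem x ⟦ k ⟧ ((1ℚ - x) ^ k)))
    (bernoulli-decay k 0≤x x≤1)
    where
    lem : ∀ x k e → (1ℚ - x) * e * (1ℚ + (1ℚ + k) * x) + e * ((1ℚ + k) * (x * x)) ≡ e * (1ℚ + k * x)
    lem = solve-∀ ℚ-ring

  bernoulli-growth : ∀ {x} k → 0ℚ ≤ x → (1ℚ + x) ^ k * (1ℚ - ⟦ k ⟧ * x) ≤ 1ℚ
  bernoulli-growth {x} zero    0≤x = ≤-reflexive (lem x)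
    where
    lem : ∀ x → 1ℚ * (1ℚ - 0ℚ * x) ≡ 1ℚ
    lem = solve-∀ ℚ-ring
  bernoulli-growth {x} (suc k) 0≤x = ≤-trans
    (≤-by ((1ℚ + x) ^ k * ((1ℚ + ⟦ k ⟧) * (x * x)))
          (*-nonneg (^-nonneg k (+-nonneg 0≤1 0≤x)) (*-nonneg (⟦⟧-nonneg (suc k)) (*-nonneg 0≤x 0≤x)))
          (lem x ⟦ k ⟧ ((1ℚ + x) ^ k)))
    (bernoulli-growth k 0≤x)
    where
    lem : ∀ x k e → (1ℚ + x) * e * (1ℚ - (1ℚ + k) * x) + e * ((1ℚ + k) * (x * x)) ≡ e * (1ℚ - k * x)
    lem = solve-∀ ℚ-ring

  -- Expectation over independent bits

  E : ℚ → ∀ {m} → (Vec Bool m → ℚ) → ℚ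
  E p {zero}  f = f []
  E p {suc m} f = p * E p (λ x → f (true ∷ x)) + (1ℚ - p) * E p (λ x → f (false ∷ x))

  E-const : ∀ p m a → E p {m} (λ _ → a) ≡ a
  E-const p zero    a = refl
  E-const p (suc m) a rewrite E-const p m a = lem p a
    where
    lem : ∀ p a → p * a + (1ℚ - p) * a ≡ a
    lem = solve-∀ ℚ-ring

  E-+ : ∀ p {m} (f g : Vec Bool m → ℚ) → E p (λ x → f x + g x) ≡ E p f + E p g
  E-+ p {zero}  f g = refl
  E-+ p {suc m} f g = trans
    (cong₂ (λ a b → p * a + (1ℚ - p) * b) (E-+ p (λ x → f (true ∷ x)) _) (E-+ p (λ x → f (false ∷ x)) _))
    (lem p _ _ _ _)
    where
    lem : ∀ p a b c d → p * (a + b) + (1ℚ - p) * (c + d) ≡ p * a + (1ℚ - p) * c + (p * b + (1ℚ - p) * d)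
    lem = solve-∀ ℚ-ring

  E-* : ∀ p {m} a (f : Vec Bool m → ℚ) → E p (λ x → a * f x) ≡ a * E p f
  E-* p {zero}  a f = refl
  E-* p {suc m} a f = trans
    (cong₂ (λ b c → p * b + (1ℚ - p) * c) (E-* p a (λ x → f (true ∷ x))) (E-* p a (λ x → f (false ∷ x))))
    (lem p a _ _)
    where
    lem : ∀ p a b c → p * (a * b) + (1ℚ - p) * (a * c) ≡ a * (p * b + (1ℚ - p) * c)
    lem = solve-∀ ℚ-ring

  E-mono : ∀ {p} → 0ℚ ≤ p → p ≤ 1ℚ → ∀ {m} {f g : Vec Bool m → ℚ} → (∀ x → f x ≤ g x) → E p f ≤ E p g
  E-mono 0≤p p≤1 {zero}  f≤g = f≤g []
  E-mono 0≤p p≤1 {suc m} f≤g = +-mono-≤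
    (*-monoʳ 0≤p (E-mono 0≤p p≤1 (λ x → f≤g (true ∷ x))))
    (*-monoʳ (gap p≤1) (E-mono 0≤p p≤1 (λ x → f≤g (false ∷ x))))

  -- The whole conditioning mechanism: to expose bit `i` is to precompose `f` with an overwrite.
  -- Overwrites compose, so conditional measures never appear.
  E-condition : ∀ p {m} (i : Fin m) (f : Vec Bool m → ℚ) →
    E p f ≡ p * E p (λ x → f (x [ i ]≔ true)) + (1ℚ - p) * E p (λ x → f (x [ i ]≔ false))
  E-condition p zero    f = sym (cong₂ (λ a b → p * a + (1ℚ - p) * b) (E-const-step _) (E-const-step _))
    where
    lem : ∀ p a → p * a + (1ℚ - p) * a ≡ a
    lem = solve-∀ ℚ-ring
    E-const-step : ∀ a → p * a + (1ℚ - p) * a ≡ a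
    E-const-step = lem p
  E-condition p (suc i) f = trans
    (cong₂ (λ a b → p * a + (1ℚ - p) * b)
      (E-condition p i (λ x → f (true ∷ x))) (E-condition p i (λ x → f (false ∷ x))))
    (lem p _ _ _ _)
    where
    lem : ∀ p a b c d → p * (p * a + (1ℚ - p) * b) + (1ℚ - p) * (p * c + (1ℚ - p) * d)
                      ≡ p * (p * a + (1ℚ - p) * c) + (1ℚ - p) * (p * b + (1ℚ - p) * d)
    lem = solve-∀ ℚ-ring

  -- The coupling behind two-round exposure: a pair is absent from the union exactly when it is
  -- absent from both independent rounds.
  E-∨ : ∀ {p a b} → 1ℚ - p ≡ (1ℚ - a) * (1ℚ - b) → ∀ {m} (f : Vec Bool m → ℚ) →
    E p f ≡ E a (λ x → E b (λ y → f (zipWith _∨_ x y)))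
  E-∨ eq {zero} f = refl
  E-∨ {p} {a} {b} eq {suc m} f = begin
    p * T + (1ℚ - p) * F                                      ≡⟨ cong (λ q → q * T + (1ℚ - p) * F) (lem₁ p) ⟩
    (1ℚ - (1ℚ - p)) * T + (1ℚ - p) * F                        ≡⟨ cong (λ q → (1ℚ - q) * T + q * F) eq ⟩
    (1ℚ - q) * T + q * F                                      ≡⟨ lem₂ a b T F ⟩
    a * (b * T + (1ℚ - b) * T) + (1ℚ - a) * (b * T + (1ℚ - b) * F)
      ≡⟨ cong₂ (λ T F → a * (b * T + (1ℚ - b) * T) + (1ℚ - a) * (b * T + (1ℚ - b) * F)) 
         (E-∨ {p} {a} {b} eq (λ x → f (true ∷ x))) (E-∨ {p} {a} {b} eq (λ x → f (false ∷ x))) ⟩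
    a * (b * T′ + (1ℚ - b) * T′) + (1ℚ - a) * (b * T′ + (1ℚ - b) * F′)
      ≡⟨ cong₂ (λ x y → a * x + (1ℚ - a) * y)
         (linear (λ x → E b (λ y → f (true ∷ zipWith _∨_ x y))) (λ x → E b (λ y → f (true ∷ zipWith _∨_ x y))))
         (linear (λ x → E b (λ y → f (true ∷ zipWith _∨_ x y))) (λ x → E b (λ y → f (false ∷ zipWith _∨_ x y)))) ⟨
    E a (λ x → E b (λ y → f (zipWith _∨_ x y))) ∎
    where
    open ≡-Reasoning
    q = (1ℚ - a) * (1ℚ - b)
    T = E p (λ x → f (true ∷ x))
    F = E p (λ x → f (false ∷ x))
    T′ = E a (λ x → E b (λ y → f (true ∷ zipWith _∨_ x y)))
    F′ = E a (λ x → E b (λ y → f (false ∷ zipWith _∨_ x y)))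
    linear : ∀ (g h : Vec Bool m → ℚ) → E a (λ x → b * g x + (1ℚ - b) * h x) ≡ b * E a g + (1ℚ - b) * E a h
    linear g h = trans (E-+ a (λ x → b * g x) (λ x → (1ℚ - b) * h x)) (cong₂ _+_ (E-* a b g) (E-* a (1ℚ - b) h))
    lem₁ : ∀ p → p ≡ 1ℚ - (1ℚ - p)
    lem₁ = solve-∀ ℚ-ring
    lem₂ : ∀ a b T F → (1ℚ - (1ℚ - a) * (1ℚ - b)) * T + (1ℚ - a) * (1ℚ - b) * F
         ≡ a * (b * T + (1ℚ - b) * T) + (1ℚ - a) * (b * T + (1ℚ - b) * F)
    lem₂ = solve-∀ ℚ-ring

  ∏ : ∀ {A : Set} → (A → ℚ) → List A → ℚ
  ∏ c []       = 1ℚ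
  ∏ c (e ∷ es) = c e * ∏ c es

  ∏-on : ∀ {A : Set} → (A → ℚ) → (es : List A) → Vec Bool (length es) → ℚ
  ∏-on c []       _            = 1ℚ
  ∏-on c (e ∷ es) (true  ∷ bs) = c e * ∏-on c es bs
  ∏-on c (e ∷ es) (false ∷ bs) = ∏-on c es bs

  -- Independence: the mean of a product of factors, one per present edge, is the product of the
  -- means.
  E-∏ : ∀ {A : Set} → ∀ p (c : A → ℚ) es → E p (∏-on c es) ≡ ∏ (λ e → 1ℚ - p + p * c e) es
  E-∏ p c []       = refl
  E-∏ p c (e ∷ es) = begin
    p * E p (λ x → c e * ∏-on c es x) + (1ℚ - p) * E p (∏-on c es)
      ≡⟨ cong (λ a → p * a + (1ℚ - p) * E p (∏-on c es)) (E-* p (c e) (∏-on c es)) ⟩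
    p * (c e * E p (∏-on c es)) + (1ℚ - p) * E p (∏-on c es)
      ≡⟨ lem p (c e) _ ⟩
    (1ℚ - p + p * c e) * E p (∏-on c es)
      ≡⟨ cong (_*_ (1ℚ - p + p * c e)) (E-∏ p c es) ⟩
    (1ℚ - p + p * c e) * ∏ (λ e → 1ℚ - p + p * c e) es ∎
    where
    open ≡-Reasoning
    lem : ∀ p c x → p * (c * x) + (1ℚ - p) * x ≡ (1ℚ - p + p * c) * x
    lem = solve-∀ ℚ-ring

  indicator : Bool → ℚ
  indicator b = if b then 1ℚ else 0ℚ

  -- The summand of `Prob` is local to its definition; unification recovers it.
  Prob-summand : Σ ((n : ℕ) → ℚ → (Graph n → Bool) → Graph n → ℚ → ℚ) λ h →
    ∀ n p S → Prob n p S ≡ foldr (h n p S) 0ℚ (allVecs (numPairs n))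
  Prob-summand = _ , λ n p S → refl

  Prob-summand≡ : ∀ n p S G acc → proj₁ Prob-summand n p S G acc ≡ weight p G * indicator (S G) + acc
  Prob-summand≡ n p S G acc with S G
  ... | true  = cong (_+ acc) (sym (*-identityʳ (weight p G)))
  ... | false = cong (_+ acc) (sym (*-zeroʳ (weight p G)))

  sumOver : ∀ {A : Set} → (A → ℚ) → List A → ℚ
  sumOver f []       = 0ℚ
  sumOver f (x ∷ xs) = f x + sumOver f xs

  sumOver-++ : ∀ {A : Set} (f : A → ℚ) (xs ys : List A) → sumOver f (xs ++ ys) ≡ sumOver f xs + sumOver f ys
  sumOver-++ f []       ys = sym (+-identityˡ _)
  sumOver-++ f (x ∷ xs) ys = trans (cong (_+_ (f x)) (sumOver-++ f xs ys)) (sym (+-assoc (f x) _ _))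

  sumOver-weighted : ∀ {A : Set} {m} a (g : Vec Bool m → A) (w : Vec Bool m → ℚ) (h : A → ℚ) →
    (∀ v → h (g v) ≡ a * w v) → ∀ vs → sumOver h (map g vs) ≡ a * sumOver w vs
  sumOver-weighted a g w h eq []       = sym (*-zeroʳ a)
  sumOver-weighted a g w h eq (v ∷ vs) =
    trans (cong₂ _+_ (eq v) (sumOver-weighted a g w h eq vs)) (sym (*-distribˡ-+ a (w v) _))

  sumOver-allVecs : ∀ p m (f : Vec Bool m → ℚ) → sumOver (λ v → weight p v * f v) (allVecs m) ≡ E p f
  sumOver-allVecs p zero    f = trans (+-identityʳ _) (*-identityˡ (f []))
  sumOver-allVecs p (suc m) f = trans (sumOver-++ wf (map (true ∷_) (allVecs m)) _) (cong₂ _+_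
    (trans (sumOver-weighted p (true ∷_) (λ v → weight p v * f (true ∷ v)) wf
             (λ v → *-assoc p (weight p v) (f (true ∷ v))) (allVecs m))
           (cong (_*_ p) (sumOver-allVecs p m (λ v → f (true ∷ v)))))
    (trans (sumOver-weighted (1ℚ - p) (false ∷_) (λ v → weight p v * f (false ∷ v)) wf
             (λ v → *-assoc (1ℚ - p) (weight p v) (f (false ∷ v))) (allVecs m))
           (cong (_*_ (1ℚ - p)) (sumOver-allVecs p m (λ v → f (false ∷ v))))))
    where
    wf : Vec Bool (suc m) → ℚ
    wf v = weight p v * f v

  Prob≡E : ∀ n p S → Prob n p S ≡ E p (λ G → indicator (S G))
  Prob≡E n p S = trans (proj₂ Prob-summand n p S)
    (trans (foldr-cong (allVecs (numPairs n))) (sumOver-allVecs p (numPairs n) (λ G → indicator (S G))))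
    where
    foldr-cong : ∀ vs → foldr (proj₁ Prob-summand n p S) 0ℚ vs ≡ sumOver (λ v → weight p v * indicator (S v)) vs
    foldr-cong []       = refl
    foldr-cong (v ∷ vs) = trans (Prob-summand≡ n p S v _) (cong (_+_ (weight p v * indicator (S v))) (foldr-cong vs))

  -- Counting over `pairs n`

  count : ∀ {A : Set} → (A → ℕ) → List A → ℕ
  count g []       = 0
  count g (x ∷ xs) = g x ℕ.+ count g xs

  count-++ : ∀ {A : Set} (g : A → ℕ) (xs ys : List A) → count g (xs ++ ys) ≡ count g xs ℕ.+ count g ys
  count-++ g []       ys = refl
  count-++ g (x ∷ xs) ys = trans (cong (g x ℕ.+_) (count-++ g xs ys)) (sym (ℕₚ.+-assoc (g x) _ _))

  count-concatMap : ∀ {A B : Set} (g : B → ℕ) (f : A → List B) xs → count g (concatMap f xs) ≡ count (λ x → count g (f x)) xs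
  count-concatMap g f []       = refl
  count-concatMap g f (x ∷ xs) = trans (count-++ g (f x) (concatMap f xs)) (cong (count g (f x) ℕ.+_) (count-concatMap g f xs))

  count-map : ∀ {A B : Set} (g : B → ℕ) (f : A → B) xs → count g (map f xs) ≡ count (g ∘ f) xs
  count-map g f []       = refl
  count-map g f (x ∷ xs) = cong (g (f x) ℕ.+_) (count-map g f xs)

  count-filter : ∀ {A : Set} {P : A → Set} (g : A → ℕ) (P? : ∀ x → Dec (P x)) xs →
    count g (filter P? xs) ≡ count (λ x → if does (P? x) then g x else 0) xs
  count-filter g P? []       = refl
  count-filter g P? (x ∷ xs) with does (P? x)
  ... | true  = cong (g x ℕ.+_) (count-filter g P? xs)
  ... | false = count-filter g P? xs

  count-tabulate : ∀ {A : Set} {n} (g : A → ℕ) (f : Fin n → A) → count g (List.tabulate f) ≡ sum (g ∘ f)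
  count-tabulate {n = zero}  g f = refl
  count-tabulate {n = suc n} g f = cong (g (f zero) ℕ.+_) (count-tabulate g (f ∘ suc))

  above : ∀ {n} → (Fin n → Fin n → ℕ) → Fin n → Fin n → ℕ
  above g i j = if does (toℕ i ℕ.<? toℕ j) then g i j else 0

  count-pairs : ∀ n (g : Fin n → Fin n → ℕ) →
    count (λ (i , j) → g i j) (pairs n) ≡ sum (λ i → sum (above g i))
  count-pairs n g = begin
    count g′ (pairs n)
      ≡⟨ count-concatMap g′ row (allFin n) ⟩
    count (λ i → count g′ (row i)) (allFin n)
      ≡⟨ count-tabulate (λ i → count g′ (row i)) (λ i → i) ⟩
    sum (λ i → count g′ (row i))
      ≡⟨ sum-cong-≗ (λ i → trans (count-map g′ (i ,_) (filter (λ j → toℕ i ℕ.<? toℕ j) (allFin n)))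
           (trans (count-filter (g i) (λ j → toℕ i ℕ.<? toℕ j) (allFin n))
                  (count-tabulate (above g i) (λ j → j)))) ⟩
    sum (λ i → sum (above g i)) ∎
    where
    open ≡-Reasoning
    g′ : Fin n × Fin n → ℕ
    g′ (i , j) = g i j
    row : Fin n → List (Fin n × Fin n)
    row i = map (λ j → i , j) (filter (λ j → toℕ i ℕ.<? toℕ j) (allFin n))

  kronecker : ∀ {n} → Fin n → ℕ → Fin n → ℕ
  kronecker i a j = if does (i Finₚ.≟ j) then a else 0

  sum-kronecker : ∀ {n} (i : Fin n) a → sum (kronecker i a) ≡ a
  sum-kronecker {suc n} zero    a = trans (cong (a ℕ.+_) (sum-zero {n} (λ j → kronecker zero a (suc j)) (λ _ → refl))) (ℕₚ.+-identityʳ a)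
  sum-kronecker {suc n} (suc i) a = sum-kronecker {n} i a

  above-< : ∀ {n} (g : Fin n → Fin n → ℕ) {i j} → toℕ i ℕ.< toℕ j → above g i j ≡ g i j
  above-< g {i} {j} i<j rewrite dec-true (toℕ i ℕ.<? toℕ j) i<j = refl

  above-≮ : ∀ {n} (g : Fin n → Fin n → ℕ) {i j} → ¬ toℕ i ℕ.< toℕ j → above g i j ≡ 0
  above-≮ g {i} {j} i≮j rewrite dec-false (toℕ i ℕ.<? toℕ j) i≮j = refl

  kronecker-≢ : ∀ {n} {i j : Fin n} a → i ≢ j → kronecker i a j ≡ 0
  kronecker-≢ {i = i} {j} a i≢j rewrite dec-false (i Finₚ.≟ j) i≢j = refl

  kronecker-≡ : ∀ {n} (i : Fin n) a → kronecker i a i ≡ a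
  kronecker-≡ i a rewrite dec-true (i Finₚ.≟ i) refl = refl

  above-split : ∀ {n} (g : Fin n → Fin n → ℕ) → (∀ i j → g i j ≡ g j i) → ∀ i j →
    above g i j ℕ.+ above g j i ℕ.+ kronecker i (g i i) j ≡ g i j
  above-split g g-sym i j with ℕₚ.<-cmp (toℕ i) (toℕ j)
  ... | tri< i<j i≢j j≮i rewrite above-< g i<j | above-≮ g j≮i | kronecker-≢ (g i i) (i≢j ∘ cong toℕ) =
    trans (ℕₚ.+-identityʳ _) (ℕₚ.+-identityʳ _)
  ... | tri> i≮j i≢j j<i rewrite above-≮ g i≮j | above-< g j<i | kronecker-≢ (g i i) (i≢j ∘ cong toℕ) =
    trans (ℕₚ.+-identityʳ _) (g-sym j i)
  ... | tri≈ i≮j i≡j j≮i with refl ← Finₚ.toℕ-injective i≡j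
    rewrite above-≮ g i≮j | kronecker-≡ i (g i i) = refl

  -- Trichotomy splits the sum over ordered pairs into two triangles and the diagonal; exchanging
  -- the order of summation identifies the triangles.
  double-count-pairs : ∀ n (g : Fin n → Fin n → ℕ) → (∀ i j → g i j ≡ g j i) →
    2 ℕ.* count (λ (i , j) → g i j) (pairs n) ℕ.+ sum (λ i → g i i) ≡ sum (λ i → sum (g i))
  double-count-pairs n g g-sym = begin
    2 ℕ.* count (λ (i , j) → g i j) (pairs n) ℕ.+ sum (λ i → g i i)
      ≡⟨ cong (λ c → 2 ℕ.* c ℕ.+ sum (λ i → g i i)) (count-pairs n g) ⟩
    2 ℕ.* U ℕ.+ sum (λ i → g i i)
      ≡⟨ cong (ℕ._+ sum (λ i → g i i)) (cong (U ℕ.+_) (ℕₚ.+-identityʳ U)) ⟩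
    U ℕ.+ U ℕ.+ sum (λ i → g i i)
      ≡⟨ cong₂ (λ a b → U ℕ.+ a ℕ.+ b) (∑-comm (above g)) (sum-cong-≗ (λ i → sym (sum-kronecker i (g i i)))) ⟩
    U ℕ.+ sum (λ i → sum (λ j → above g j i)) ℕ.+ sum (λ i → sum (kronecker i (g i i)))
      ≡⟨ cong (ℕ._+ sum (λ i → sum (kronecker i (g i i)))) (∑-distrib-+ (λ i → sum (above g i)) (λ i → sum (λ j → above g j i))) ⟨
    sum (λ i → sum (above g i) ℕ.+ sum (λ j → above g j i)) ℕ.+ sum (λ i → sum (kronecker i (g i i)))
      ≡⟨ ∑-distrib-+ (λ i → sum (above g i) ℕ.+ sum (λ j → above g j i)) (λ i → sum (kronecker i (g i i))) ⟨
    sum (λ i → sum (above g i) ℕ.+ sum (λ j → above g j i) ℕ.+ sum (kronecker i (g i i)))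
      ≡⟨ sum-cong-≗ (λ i → trans
           (cong (ℕ._+ sum (kronecker i (g i i))) (sym (∑-distrib-+ (above g i) (λ j → above g j i))))
           (trans (sym (∑-distrib-+ (λ j → above g i j ℕ.+ above g j i) (kronecker i (g i i))))
                  (sum-cong-≗ (above-split g g-sym i)))) ⟩
    sum (λ i → sum (g i)) ∎
    where
    open ≡-Reasoning
    U = sum (λ i → sum (above g i))

  sum-product : ∀ {m n} (f : Fin m → ℕ) (g : Fin n → ℕ) → sum (λ i → sum (λ j → f i ℕ.* g j)) ≡ sum f ℕ.* sum g
  sum-product f g = trans (sum-cong-≗ (λ i → sym (*-distribˡ-sum (f i) g))) (sym (*-distribʳ-sum (sum g) f))

  -- Partial 2-colourings

  PartialColouring : ℕ → Set
  PartialColouring n = Fin n → Maybe Bool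

  inside mono bichrom : Maybe Bool → Maybe Bool → ℕ
  inside (just _) (just _) = 1
  inside _        _        = 0
  mono (just a) (just b) = same a b
  mono _        _        = 0
  bichrom (just a) (just b) = same a (not b)
  bichrom _        _        = 0

  isTrue isFalse : Maybe Bool → ℕ
  isTrue (just true)  = 1
  isTrue _            = 0
  isFalse (just false) = 1
  isFalse _            = 0

  mono≡ : ∀ a b → mono a b ≡ isTrue a ℕ.* isTrue b ℕ.+ isFalse a ℕ.* isFalse b
  mono≡ (just true)  (just true)  = refl
  mono≡ (just true)  (just false) = refl
  mono≡ (just true)  nothing      = refl
  mono≡ (just false) (just true)  = refl
  mono≡ (just false) (just false) = refl
  mono≡ (just false) nothing      = refl
  mono≡ nothing      b            = refl

  bichrom≡ : ∀ a b → bichrom a b ≡ isTrue a ℕ.* isFalse b ℕ.+ isFalse a ℕ.* isTrue b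
  bichrom≡ (just true)  (just true)  = refl
  bichrom≡ (just true)  (just false) = refl
  bichrom≡ (just true)  nothing      = refl
  bichrom≡ (just false) (just true)  = refl
  bichrom≡ (just false) (just false) = refl
  bichrom≡ (just false) nothing      = refl
  bichrom≡ nothing      b            = refl

  mono-diagonal : ∀ a → mono a a ≡ inside a a
  mono-diagonal (just true)  = refl
  mono-diagonal (just false) = refl
  mono-diagonal nothing      = refl

  inside-diagonal : ∀ a → inside a a ≡ isTrue a ℕ.+ isFalse a
  inside-diagonal (just true)  = refl
  inside-diagonal (just false) = refl
  inside-diagonal nothing      = refl

  size : ∀ {n} → PartialColouring n → ℕ
  size κ = sum (λ v → inside (κ v) (κ v))

  module PairCounts {n} (κ : PartialColouring n) where
    X = sum (isTrue ∘ κ)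
    Y = sum (isFalse ∘ κ)

    size≡ : size κ ≡ X ℕ.+ Y
    size≡ = trans (sum-cong-≗ (λ v → inside-diagonal (κ v))) (∑-distrib-+ (isTrue ∘ κ) (isFalse ∘ κ))

    ∑∑-split : ∀ (f g h k : Fin n → ℕ) →
      sum (λ i → sum (λ j → f i ℕ.* g j ℕ.+ h i ℕ.* k j)) ≡ sum f ℕ.* sum g ℕ.+ sum h ℕ.* sum k
    ∑∑-split f g h k = trans
      (sum-cong-≗ (λ i → ∑-distrib-+ (λ j → f i ℕ.* g j) (λ j → h i ℕ.* k j)))
      (trans (∑-distrib-+ (λ i → sum (λ j → f i ℕ.* g j)) (λ i → sum (λ j → h i ℕ.* k j)))
             (cong₂ ℕ._+_ (sum-product f g) (sum-product h k)))

    monoPairs = count (λ (i , j) → mono (κ i) (κ j)) (pairs n)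
    bichromPairs = count (λ (i , j) → bichrom (κ i) (κ j)) (pairs n)

    mono-count : 2 ℕ.* monoPairs ℕ.+ size κ ≡ X ℕ.* X ℕ.+ Y ℕ.* Y
    mono-count = begin
      2 ℕ.* monoPairs ℕ.+ size κ
        ≡⟨ cong (2 ℕ.* monoPairs ℕ.+_) (sum-cong-≗ (λ v → sym (mono-diagonal (κ v)))) ⟩
      2 ℕ.* monoPairs ℕ.+ sum (λ v → mono (κ v) (κ v))
        ≡⟨ double-count-pairs n (λ i j → mono (κ i) (κ j)) (λ i j → mono-sym (κ i) (κ j)) ⟩
      sum (λ i → sum (λ j → mono (κ i) (κ j)))
        ≡⟨ sum-cong-≗ (λ i → sum-cong-≗ (λ j → mono≡ (κ i) (κ j))) ⟩
      _ ≡⟨ ∑∑-split (isTrue ∘ κ) (isTrue ∘ κ) (isFalse ∘ κ) (isFalse ∘ κ) ⟩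
      X ℕ.* X ℕ.+ Y ℕ.* Y ∎
      where
      open ≡-Reasoning
      mono-sym : ∀ a b → mono a b ≡ mono b a
      mono-sym (just a) (just b) = same-sym a b
      mono-sym (just a) nothing  = refl
      mono-sym nothing  (just b) = refl
      mono-sym nothing  nothing  = refl

    bichrom-count : 2 ℕ.* bichromPairs ℕ.≤ X ℕ.* Y ℕ.+ Y ℕ.* X
    bichrom-count = begin
      2 ℕ.* bichromPairs
        ≤⟨ ℕₚ.m≤m+n _ _ ⟩
      2 ℕ.* bichromPairs ℕ.+ sum (λ v → bichrom (κ v) (κ v))
        ≡⟨ double-count-pairs n (λ i j → bichrom (κ i) (κ j)) (λ i j → bichrom-sym (κ i) (κ j)) ⟩
      sum (λ i → sum (λ j → bichrom (κ i) (κ j)))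
        ≡⟨ sum-cong-≗ (λ i → sum-cong-≗ (λ j → bichrom≡ (κ i) (κ j))) ⟩
      _ ≡⟨ ∑∑-split (isTrue ∘ κ) (isFalse ∘ κ) (isFalse ∘ κ) (isTrue ∘ κ) ⟩
      X ℕ.* Y ℕ.+ Y ℕ.* X ∎
      where
      open ℕₚ.≤-Reasoning
      bichrom-sym : ∀ a b → bichrom a b ≡ bichrom b a
      bichrom-sym (just true)  (just true)  = refl
      bichrom-sym (just true)  (just false) = refl
      bichrom-sym (just false) (just true)  = refl
      bichrom-sym (just false) (just false) = refl
      bichrom-sym (just a) nothing  = refl
      bichrom-sym nothing  (just b) = refl
      bichrom-sym nothing  nothing  = refl

    2xy≤x²+y² : ∀ x y → x ℕ.* y ℕ.+ y ℕ.* x ℕ.≤ x ℕ.* x ℕ.+ y ℕ.* y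
    2xy≤x²+y² x y with ℕₚ.≤-total x y
    ... | inj₁ x≤y with d , refl ← ℕₚ.m≤n⇒∃[o]m+o≡n x≤y = subst (x ℕ.* (x ℕ.+ d) ℕ.+ (x ℕ.+ d) ℕ.* x ℕ.≤_) (lem x d) (ℕₚ.m≤m+n _ (d ℕ.* d))
      where
      lem : ∀ x d → x ℕ.* (x ℕ.+ d) ℕ.+ (x ℕ.+ d) ℕ.* x ℕ.+ d ℕ.* d ≡ x ℕ.* x ℕ.+ (x ℕ.+ d) ℕ.* (x ℕ.+ d)
      lem = ℕ-solve-∀
    ... | inj₂ y≤x with d , refl ← ℕₚ.m≤n⇒∃[o]m+o≡n y≤x = subst ((y ℕ.+ d) ℕ.* y ℕ.+ y ℕ.* (y ℕ.+ d) ℕ.≤_) (lem y d) (ℕₚ.m≤m+n _ (d ℕ.* d))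
      where
      lem : ∀ y d → (y ℕ.+ d) ℕ.* y ℕ.+ y ℕ.* (y ℕ.+ d) ℕ.+ d ℕ.* d ≡ (y ℕ.+ d) ℕ.* (y ℕ.+ d) ℕ.+ y ℕ.* y
      lem = ℕ-solve-∀

    square : size κ ℕ.* size κ ≡ X ℕ.* X ℕ.+ Y ℕ.* Y ℕ.+ (X ℕ.* Y ℕ.+ Y ℕ.* X)
    square = trans (cong₂ ℕ._*_ size≡ size≡) (lem X Y)
      where
      lem : ∀ x y → (x ℕ.+ y) ℕ.* (x ℕ.+ y) ≡ x ℕ.* x ℕ.+ y ℕ.* y ℕ.+ (x ℕ.* y ℕ.+ y ℕ.* x)
      lem = ℕ-solve-∀

    -- The colour classes satisfy `X² + Y² ≥ s² / 2`, so about `s² / 4 ≥ 2 r s` pairs are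
    -- monochromatic. Half of this bound is given up to absorb the diagonal.
    many-mono : ∀ r → 1 ℕ.≤ r → 8 ℕ.* r ℕ.≤ size κ → size κ ℕ.* r ℕ.≤ monoPairs
    many-mono r 1≤r 8r≤s = ℕₚ.*-cancelˡ-≤ 4 (ℕₚ.+-cancelʳ-≤ (2 ℕ.* s) _ _ (begin
      4 ℕ.* (s ℕ.* r) ℕ.+ 2 ℕ.* s                          ≤⟨ ℕₚ.+-monoʳ-≤ (4 ℕ.* (s ℕ.* r)) 2s≤4sr ⟩
      4 ℕ.* (s ℕ.* r) ℕ.+ 4 ℕ.* (s ℕ.* r)                  ≡⟨ lem₂ s r ⟩
      s ℕ.* (8 ℕ.* r)                                      ≤⟨ ℕₚ.*-monoʳ-≤ s 8r≤s ⟩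
      s ℕ.* s                                              ≡⟨ square ⟩
      X ℕ.* X ℕ.+ Y ℕ.* Y ℕ.+ (X ℕ.* Y ℕ.+ Y ℕ.* X)        ≤⟨ ℕₚ.+-monoʳ-≤ (X ℕ.* X ℕ.+ Y ℕ.* Y) (2xy≤x²+y² X Y) ⟩
      X ℕ.* X ℕ.+ Y ℕ.* Y ℕ.+ (X ℕ.* X ℕ.+ Y ℕ.* Y)        ≡⟨ cong₂ ℕ._+_ mono-count mono-count ⟨
      (2 ℕ.* monoPairs ℕ.+ s) ℕ.+ (2 ℕ.* monoPairs ℕ.+ s)  ≡⟨ lem₃ monoPairs s ⟩
      4 ℕ.* monoPairs ℕ.+ 2 ℕ.* s                          ∎))
      where
      open ℕₚ.≤-Reasoning
      s = size κ
      lem₁ : ∀ s → 2 ℕ.* s ℕ.+ 2 ℕ.* s ≡ 4 ℕ.* (s ℕ.* 1)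
      lem₁ = ℕ-solve-∀
      lem₂ : ∀ s r → 4 ℕ.* (s ℕ.* r) ℕ.+ 4 ℕ.* (s ℕ.* r) ≡ s ℕ.* (8 ℕ.* r)
      lem₂ = ℕ-solve-∀
      lem₃ : ∀ m s → (2 ℕ.* m ℕ.+ s) ℕ.+ (2 ℕ.* m ℕ.+ s) ≡ 4 ℕ.* m ℕ.+ 2 ℕ.* s
      lem₃ = ℕ-solve-∀
      2s≤4sr : 2 ℕ.* s ℕ.≤ 4 ℕ.* (s ℕ.* r)
      2s≤4sr = ℕₚ.≤-trans (ℕₚ.m≤m+n (2 ℕ.* s) (2 ℕ.* s)) (ℕₚ.≤-trans (ℕₚ.≤-reflexive (lem₁ s))
        (ℕₚ.*-monoʳ-≤ 4 (ℕₚ.*-monoʳ-≤ s 1≤r)))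

    -- At most `s² / 2` pairs are bichromatic. Bounding this linearly in `s` is what requires the
    -- tree to have size at most `16 r`.
    few-bichrom : ∀ r → size κ ℕ.≤ 16 ℕ.* r → bichromPairs ℕ.≤ size κ ℕ.* (8 ℕ.* r)
    few-bichrom r s≤16r = ℕₚ.*-cancelˡ-≤ 2 (begin
      2 ℕ.* bichromPairs                             ≤⟨ bichrom-count ⟩
      X ℕ.* Y ℕ.+ Y ℕ.* X                            ≤⟨ ℕₚ.m≤n+m _ (X ℕ.* X ℕ.+ Y ℕ.* Y) ⟩
      X ℕ.* X ℕ.+ Y ℕ.* Y ℕ.+ (X ℕ.* Y ℕ.+ Y ℕ.* X)  ≡⟨ square ⟨
      size κ ℕ.* size κ                              ≤⟨ ℕₚ.*-monoʳ-≤ (size κ) s≤16r ⟩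
      size κ ℕ.* (16 ℕ.* r)                          ≡⟨ lem (size κ) r ⟩
      2 ℕ.* (size κ ℕ.* (8 ℕ.* r))                   ∎)
      where
      open ℕₚ.≤-Reasoning
      lem : ∀ s r → s ℕ.* (16 ℕ.* r) ≡ 2 ℕ.* (s ℕ.* (8 ℕ.* r))
      lem = ℕ-solve-∀

  -- Trees, their colourings and violated tree edges

  data Tree {V : Set} (R : V → V → Set) : List V → Set where
    root : ∀ r → Tree R (r ∷ [])
    grow : ∀ {xs u w} → Tree R xs → u ∈ xs → w ∉ xs → R u w → Tree R (w ∷ xs)

  Tree-map : ∀ {V : Set} {R S : V → V → Set} → (∀ {u w} → R u w → S u w) → ∀ {xs} → Tree R xs → Tree S xs
  Tree-map f (root r)          = root r
  Tree-map f (grow T u∈ w∉ e) = grow (Tree-map f T) u∈ w∉ (f e)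

  Colouring : ∀ {V : Set} → List V → Set
  Colouring xs = All (λ _ → Bool) xs

  -- Each new leaf is compared with its parent only, so the colour of the root and the set of
  -- violated edges determine the colouring.
  violations : ∀ {V : Set} {R : V → V → Set} {xs} → Tree R xs → Colouring xs → ℕ
  violations (root r)         _        = 0
  violations (grow T u∈ _ _) (b ∷ bs) = same (All.lookup bs u∈) b ℕ.+ violations T bs

  lookup-universal : ∀ {V : Set} (σ : V → Bool) {xs u} (u∈ : u ∈ xs) → All.lookup (All.universal σ xs) u∈ ≡ σ u
  lookup-universal σ (here refl) = refl
  lookup-universal σ (there u∈)  = lookup-universal σ u∈

  ∑ᶜ : ∀ {V : Set} (xs : List V) → (Colouring xs → ℚ) → ℚ
  ∑ᶜ []       f = f []
  ∑ᶜ (x ∷ xs) f = ∑ᶜ xs (λ bs → f (true ∷ bs)) + ∑ᶜ xs (λ bs → f (false ∷ bs))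

  ∑ᶜ-mono : ∀ {V : Set} (xs : List V) {f g} → (∀ bs → f bs ≤ g bs) → ∑ᶜ xs f ≤ ∑ᶜ xs g
  ∑ᶜ-mono []       f≤g = f≤g []
  ∑ᶜ-mono (x ∷ xs) f≤g = +-mono-≤ (∑ᶜ-mono xs (λ bs → f≤g (true ∷ bs))) (∑ᶜ-mono xs (λ bs → f≤g (false ∷ bs)))

  ∑ᶜ-+ : ∀ {V : Set} (xs : List V) f g → ∑ᶜ xs (λ bs → f bs + g bs) ≡ ∑ᶜ xs f + ∑ᶜ xs g
  ∑ᶜ-+ []       f g = refl
  ∑ᶜ-+ (x ∷ xs) f g = trans
    (cong₂ _+_ (∑ᶜ-+ xs (λ bs → f (true ∷ bs)) (λ bs → g (true ∷ bs))) (∑ᶜ-+ xs (λ bs → f (false ∷ bs)) (λ bs → g (false ∷ bs))))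
    (lem (∑ᶜ xs (λ bs → f (true ∷ bs))) (∑ᶜ xs (λ bs → g (true ∷ bs)))
         (∑ᶜ xs (λ bs → f (false ∷ bs))) (∑ᶜ xs (λ bs → g (false ∷ bs))))
    where
    lem : ∀ a b c d → a + b + (c + d) ≡ a + c + (b + d)
    lem = solve-∀ ℚ-ring

  ∑ᶜ-* : ∀ {V : Set} (xs : List V) a f → ∑ᶜ xs (λ bs → a * f bs) ≡ a * ∑ᶜ xs f
  ∑ᶜ-* []       a f = refl
  ∑ᶜ-* (x ∷ xs) a f = trans (cong₂ _+_ (∑ᶜ-* xs a (λ bs → f (true ∷ bs))) (∑ᶜ-* xs a (λ bs → f (false ∷ bs))))
    (sym (*-distribˡ-+ a _ _))

  ∑ᶜ-cong : ∀ {V : Set} (xs : List V) {f g} → (∀ bs → f bs ≡ g bs) → ∑ᶜ xs f ≡ ∑ᶜ xs g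
  ∑ᶜ-cong []       f≡g = f≡g []
  ∑ᶜ-cong (x ∷ xs) f≡g = cong₂ _+_ (∑ᶜ-cong xs (λ bs → f≡g (true ∷ bs))) (∑ᶜ-cong xs (λ bs → f≡g (false ∷ bs)))

  ∑ᶜ-nonneg : ∀ {V : Set} (xs : List V) {f} → (∀ bs → 0ℚ ≤ f bs) → 0ℚ ≤ ∑ᶜ xs f
  ∑ᶜ-nonneg []       0≤f = 0≤f []
  ∑ᶜ-nonneg (x ∷ xs) 0≤f = +-nonneg (∑ᶜ-nonneg xs (λ bs → 0≤f (true ∷ bs))) (∑ᶜ-nonneg xs (λ bs → 0≤f (false ∷ bs)))

  term≤∑ᶜ : ∀ {V : Set} (xs : List V) {f} → (∀ bs → 0ℚ ≤ f bs) → ∀ bs → f bs ≤ ∑ᶜ xs f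
  term≤∑ᶜ []       0≤f [] = ≤-refl
  term≤∑ᶜ (x ∷ xs) {f} 0≤f (true ∷ bs) = ≤-trans (term≤∑ᶜ xs (λ bs → 0≤f (true ∷ bs)) bs)
    (≤-by (∑ᶜ xs (λ bs → f (false ∷ bs))) (∑ᶜ-nonneg xs (λ bs → 0≤f (false ∷ bs))) refl)
  term≤∑ᶜ (x ∷ xs) {f} 0≤f (false ∷ bs) = ≤-trans (term≤∑ᶜ xs (λ bs → 0≤f (false ∷ bs)) bs)
    (≤-by (∑ᶜ xs (λ bs → f (true ∷ bs))) (∑ᶜ-nonneg xs (λ bs → 0≤f (true ∷ bs))) (+-comm (∑ᶜ xs (λ bs → f (false ∷ bs))) _))

  E-∑ᶜ : ∀ {V : Set} (xs : List V) p {m} (f : Colouring xs → Vec Bool m → ℚ) →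
    E p (λ x → ∑ᶜ xs (λ bs → f bs x)) ≡ ∑ᶜ xs (λ bs → E p (f bs))
  E-∑ᶜ []       p f = refl
  E-∑ᶜ (x ∷ xs) p f = trans (E-+ p (λ v → ∑ᶜ xs (λ bs → f (true ∷ bs) v)) (λ v → ∑ᶜ xs (λ bs → f (false ∷ bs) v)))
    (cong₂ _+_ (E-∑ᶜ xs p (λ bs → f (true ∷ bs))) (E-∑ᶜ xs p (λ bs → f (false ∷ bs))))

  -- Exactly one of the two colours of a new leaf violates its edge, hence the factor 1 + y per edge.
  ∑ᶜ-violations : ∀ {V : Set} {R : V → V → Set} {xs} (T : Tree R xs) {y} → 0ℚ ≤ y →
    ∑ᶜ xs (λ bs → y ^ violations T bs) ≤ (1ℚ + 1ℚ) * (1ℚ + y) ^ length xs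
  ∑ᶜ-violations (root r) {y} 0≤y = ≤-by (y + y) (+-nonneg 0≤y 0≤y) (lem y)
    where
    lem : ∀ y → 1ℚ + 1ℚ + (y + y) ≡ (1ℚ + 1ℚ) * ((1ℚ + y) * 1ℚ)
    lem = solve-∀ ℚ-ring
  ∑ᶜ-violations (grow {xs} T u∈ w∉ e) {y} 0≤y = begin
    ∑ᶜ xs (λ bs → y ^ violations T′ (true ∷ bs)) + ∑ᶜ xs (λ bs → y ^ violations T′ (false ∷ bs))
      ≡⟨ ∑ᶜ-+ xs (λ bs → y ^ violations T′ (true ∷ bs)) (λ bs → y ^ violations T′ (false ∷ bs)) ⟨
    ∑ᶜ xs (λ bs → y ^ violations T′ (true ∷ bs) + y ^ violations T′ (false ∷ bs))
      ≡⟨ ∑ᶜ-cong xs (λ bs → pair (All.lookup bs u∈) (violations T bs)) ⟩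
    ∑ᶜ xs (λ bs → (1ℚ + y) * y ^ violations T bs)
      ≡⟨ ∑ᶜ-* xs (1ℚ + y) (λ bs → y ^ violations T bs) ⟩
    (1ℚ + y) * ∑ᶜ xs (λ bs → y ^ violations T bs)
      ≤⟨ *-monoʳ (+-nonneg 0≤1 0≤y) (∑ᶜ-violations T 0≤y) ⟩
    (1ℚ + y) * ((1ℚ + 1ℚ) * (1ℚ + y) ^ length xs)
      ≡⟨ lem y _ ⟩
    (1ℚ + 1ℚ) * ((1ℚ + y) * (1ℚ + y) ^ length xs) ∎
    where
    open ≤-Reasoning
    T′ = grow T u∈ w∉ e
    pair : ∀ a k → y ^ (same a true ℕ.+ k) + y ^ (same a false ℕ.+ k) ≡ (1ℚ + y) * y ^ k
    pair true  k = lem₁ y (y ^ k)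
      where
      lem₁ : ∀ y z → y * z + z ≡ (1ℚ + y) * z
      lem₁ = solve-∀ ℚ-ring
    pair false k = lem₂ y (y ^ k)
      where
      lem₂ : ∀ y z → z + y * z ≡ (1ℚ + y) * z
      lem₂ = solve-∀ ℚ-ring
    lem : ∀ y z → (1ℚ + y) * ((1ℚ + 1ℚ) * z) ≡ (1ℚ + 1ℚ) * ((1ℚ + y) * z)
    lem = solve-∀ ℚ-ring

  partial : ∀ {n} (xs : List (Fin n)) → Colouring xs → PartialColouring n
  partial []       []       v = nothing
  partial (x ∷ xs) (b ∷ bs) v = if does (x Finₚ.≟ v) then just b else partial xs bs v

  partial-∉ : ∀ {n} {xs : List (Fin n)} (bs : Colouring xs) {v} → v ∉ xs → partial xs bs v ≡ nothing
  partial-∉ []                 v∉ = refl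
  partial-∉ {xs = x ∷ xs} (b ∷ bs) {v} v∉ with x Finₚ.≟ v
  ... | yes refl = contradiction (here refl) v∉
  ... | no _     = partial-∉ bs (v∉ ∘ there)

  size-∷ : ∀ {n} {xs : List (Fin n)} {x} → x ∉ xs → ∀ b (bs : Colouring xs) →
    size (partial (x ∷ xs) (b ∷ bs)) ≡ suc (size (partial xs bs))
  size-∷ {n} {xs} {x} x∉ b bs = begin
    size (partial (x ∷ xs) (b ∷ bs))
      ≡⟨ sum-cong-≗ split ⟩
    sum (λ v → kronecker x 1 v ℕ.+ inside (κ v) (κ v))
      ≡⟨ ∑-distrib-+ (kronecker x 1) (λ v → inside (κ v) (κ v)) ⟩
    sum (kronecker x 1) ℕ.+ size κ
      ≡⟨ cong (ℕ._+ size κ) (sum-kronecker x 1) ⟩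
    suc (size κ) ∎
    where
    open ≡-Reasoning
    κ  = partial xs bs
    κ′ = partial (x ∷ xs) (b ∷ bs)
    split : ∀ v → inside (κ′ v) (κ′ v) ≡ kronecker x 1 v ℕ.+ inside (κ v) (κ v)
    split v with x Finₚ.≟ v
    ... | yes refl rewrite partial-∉ bs x∉ = refl
    ... | no _     = refl

  size-partial : ∀ {n} {R : Fin n → Fin n → Set} {xs} → Tree R xs → ∀ bs → size (partial xs bs) ≡ length xs
  size-partial {n} (root r) (b ∷ []) = trans (size-∷ {n} {[]} {r} (λ ()) b []) (cong suc (sum-zero {n} (λ _ → 0) (λ _ → refl)))
  size-partial (grow T _ w∉ _) (b ∷ bs) = trans (size-∷ w∉ b bs) (cong suc (size-partial T bs))

  -- Weights and counts over the sprinkled edges inside the tree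

  ∏-mono : ∀ {A : Set} {f g : A → ℚ} → (∀ e → 0ℚ ≤ f e) → (∀ e → f e ≤ g e) → ∀ es → ∏ f es ≤ ∏ g es
  ∏-mono 0≤f f≤g []       = ≤-refl
  ∏-mono {f = f} {g} 0≤f f≤g (e ∷ es) = *-mono (0≤f e) (∏-nonneg es) (f≤g e) (∏-mono 0≤f f≤g es)
    where
    ∏-nonneg : ∀ es → 0ℚ ≤ ∏ g es
    ∏-nonneg []       = 0≤1
    ∏-nonneg (e ∷ es) = *-nonneg (≤-trans (0≤f e) (f≤g e)) (∏-nonneg es)

  ∏-powers : ∀ {A : Set} a b (g h : A → ℕ) es → ∏ (λ e → a ^ g e * b ^ h e) es ≡ a ^ count g es * b ^ count h es
  ∏-powers a b g h []       = refl
  ∏-powers a b g h (e ∷ es) = begin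
    a ^ g e * b ^ h e * ∏ (λ e → a ^ g e * b ^ h e) es
      ≡⟨ cong (_*_ (a ^ g e * b ^ h e)) (∏-powers a b g h es) ⟩
    a ^ g e * b ^ h e * (a ^ count g es * b ^ count h es)
      ≡⟨ lem (a ^ g e) (b ^ h e) (a ^ count g es) (b ^ count h es) ⟩
    a ^ g e * a ^ count g es * (b ^ h e * b ^ count h es)
      ≡⟨ cong₂ _*_ (^-+ a (g e) (count g es)) (^-+ b (h e) (count h es)) ⟨
    a ^ (g e ℕ.+ count g es) * b ^ (h e ℕ.+ count h es) ∎
    where
    open ≡-Reasoning
    lem : ∀ w x y z → w * x * (y * z) ≡ w * y * (x * z)
    lem = solve-∀ ℚ-ring

  countOn : ∀ {A : Set} → (A → ℕ) → (es : List A) → Vec Bool (length es) → ℕ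
  countOn g []       _            = 0
  countOn g (e ∷ es) (true  ∷ bs) = g e ℕ.+ countOn g es bs
  countOn g (e ∷ es) (false ∷ bs) = countOn g es bs

  ∏-on-powers : ∀ {A : Set} a b (g h : A → ℕ) es bs →
    ∏-on (λ e → a ^ g e * b ^ h e) es bs ≡ a ^ countOn g es bs * b ^ countOn h es bs
  ∏-on-powers a b g h []       bs           = refl
  ∏-on-powers a b g h (e ∷ es) (true ∷ bs) = begin
    a ^ g e * b ^ h e * ∏-on (λ e → a ^ g e * b ^ h e) es bs
      ≡⟨ cong (_*_ (a ^ g e * b ^ h e)) (∏-on-powers a b g h es bs) ⟩
    a ^ g e * b ^ h e * (a ^ countOn g es bs * b ^ countOn h es bs)
      ≡⟨ lem (a ^ g e) (b ^ h e) (a ^ countOn g es bs) (b ^ countOn h es bs) ⟩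
    a ^ g e * a ^ countOn g es bs * (b ^ h e * b ^ countOn h es bs)
      ≡⟨ cong₂ _*_ (^-+ a (g e) (countOn g es bs)) (^-+ b (h e) (countOn h es bs)) ⟨
    a ^ (g e ℕ.+ countOn g es bs) * b ^ (h e ℕ.+ countOn h es bs) ∎
    where
    open ≡-Reasoning
    lem : ∀ w x y z → w * x * (y * z) ≡ w * y * (x * z)
    lem = solve-∀ ℚ-ring
  ∏-on-powers a b g h (e ∷ es) (false ∷ bs) = ∏-on-powers a b g h es bs

  ∏-on-nonneg : ∀ {A : Set} {c : A → ℚ} → (∀ e → 0ℚ ≤ c e) → ∀ es bs → 0ℚ ≤ ∏-on c es bs
  ∏-on-nonneg 0≤c []       bs           = 0≤1
  ∏-on-nonneg 0≤c (e ∷ es) (true ∷ bs)  = *-nonneg (0≤c e) (∏-on-nonneg 0≤c es bs)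
  ∏-on-nonneg 0≤c (e ∷ es) (false ∷ bs) = ∏-on-nonneg 0≤c es bs

  ∑-countOn : ∀ {n k} (g : Fin k → Fin n × Fin n → ℕ) (h : Fin n × Fin n → ℕ) es bs →
    All (λ e → sum (λ c → g c e) ℕ.≤ h e) (edgeList {n} es bs) →
    sum (λ c → countOn (g c) es bs) ℕ.≤ countOn h es bs
  ∑-countOn {k = k} g h []       bs           ps       = ℕₚ.≤-reflexive (sum-zero {k} (λ _ → 0) (λ _ → refl))
  ∑-countOn g h (e ∷ es) (true ∷ bs)  (p ∷ ps) = ℕₚ.≤-trans
    (ℕₚ.≤-reflexive (∑-distrib-+ (λ c → g c e) (λ c → countOn (g c) es bs)))
    (ℕₚ.+-mono-≤ p (∑-countOn g h es bs ps))
  ∑-countOn g h (e ∷ es) (false ∷ bs) ps       = ∑-countOn g h es bs ps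

  countOn-cong : ∀ {A : Set} {f g : A → ℕ} → (∀ e → f e ≡ g e) → ∀ es bs → countOn f es bs ≡ countOn g es bs
  countOn-cong f≡g []       bs           = refl
  countOn-cong f≡g (e ∷ es) (true ∷ bs)  = cong₂ ℕ._+_ (f≡g e) (countOn-cong f≡g es bs)
  countOn-cong f≡g (e ∷ es) (false ∷ bs) = countOn-cong f≡g es bs

  restrict : ∀ {n} → List (Fin n) → (Fin n → Bool) → PartialColouring n
  restrict xs σ = partial xs (All.universal σ xs)

  restrict-value : ∀ {n} (xs : List (Fin n)) v →
    (∀ σ → restrict xs σ v ≡ just (σ v)) ⊎ (∀ σ → restrict xs σ v ≡ nothing)
  restrict-value []       v = inj₂ λ σ → refl
  restrict-value (x ∷ xs) v with x Finₚ.≟ v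
  ... | yes refl = inj₁ λ σ → refl
  ... | no _     = restrict-value xs v

  within : ∀ {n} → List (Fin n) → Fin n × Fin n → ℕ
  within xs (i , j) = inside (restrict xs (λ _ → true) i) (restrict xs (λ _ → true) j)

  -- Which edges lie inside the tree does not depend on the colouring, so the pigeonhole argument
  -- compares all cuts against one common number of edges.
  inside-restrict : ∀ {n} (xs : List (Fin n)) σ i j → inside (restrict xs σ i) (restrict xs σ j) ≡ within xs (i , j)
  inside-restrict xs σ i j with restrict-value xs i | restrict-value xs j
  ... | inj₁ p | inj₁ q rewrite p σ | p (λ _ → true) | q σ | q (λ _ → true) = refl
  ... | inj₁ p | inj₂ q rewrite p σ | p (λ _ → true) | q σ | q (λ _ → true) = refl
  ... | inj₂ p | _      rewrite p σ | p (λ _ → true) = refl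

  ∑-mono-restrict : ∀ {n k} (xs : List (Fin n)) (σ : Family k n) e → monochromatic σ e ℕ.≤ 1 →
    sum (λ c → mono (restrict xs (σ c) (proj₁ e)) (restrict xs (σ c) (proj₂ e))) ℕ.≤ within xs e
  ∑-mono-restrict {k = k} xs σ (i , j) sep with restrict-value xs i | restrict-value xs j
  ... | inj₁ p | inj₁ q rewrite p (λ _ → true) | q (λ _ → true) =
    subst (ℕ._≤ 1) (sum-cong-≗ (λ c → sym (cong₂ mono (p (σ c)) (q (σ c))))) sep
  ... | inj₁ p | inj₂ q = subst (ℕ._≤ within xs (i , j))
    (sym (sum-zero {k} _ (λ c → cong₂ mono (p (σ c)) (q (σ c))))) z≤n
  ... | inj₂ p | _      = subst (ℕ._≤ within xs (i , j))
    (sym (sum-zero {k} _ (λ c → cong (λ a → mono a (restrict xs (σ c) j)) (p (σ c))))) z≤n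

  -- Every tree edge is violated by at most one member of the family. The number of vertices exceeds
  -- the number of edges by one, which only adds slack.
  ∑-violations : ∀ {n k} {R : Fin n → Fin n → Set} {xs} (T : Tree R xs) (σ : Family k n) →
    (∀ {u w} → R u w → monochromatic σ (u , w) ℕ.≤ 1) →
    sum (λ c → violations T (All.universal (σ c) xs)) ℕ.≤ length xs
  ∑-violations {k = k} (root r) σ sep = subst (ℕ._≤ 1) (sym (sum-zero {k} _ (λ _ → refl))) z≤n
  ∑-violations (grow {xs} {u} {w} T u∈ w∉ e) σ sep = begin
    sum (λ c → same (All.lookup (All.universal (σ c) xs) u∈) (σ c w) ℕ.+ violations T (All.universal (σ c) xs))
      ≡⟨ sum-cong-≗ (λ c → cong (λ b → same b (σ c w) ℕ.+ violations T (All.universal (σ c) xs)) (lookup-universal (σ c) u∈)) ⟩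
    sum (λ c → same (σ c u) (σ c w) ℕ.+ violations T (All.universal (σ c) xs))
      ≡⟨ ∑-distrib-+ (λ c → same (σ c u) (σ c w)) (λ c → violations T (All.universal (σ c) xs)) ⟩
    monochromatic σ (u , w) ℕ.+ sum (λ c → violations T (All.universal (σ c) xs))
      ≤⟨ ℕₚ.+-mono-≤ (sep e) (∑-violations T σ sep) ⟩
    suc (length xs) ∎
    where open ℕₚ.≤-Reasoning

  -- The weighted union bound over colourings of the tree

  indicator-≤ : ∀ b {z} → 0ℚ ≤ z → (b ≡ true → 1ℚ ≤ z) → indicator b ≤ z
  indicator-≤ true  0≤z 1≤z = 1≤z refl
  indicator-≤ false 0≤z 1≤z = 0≤z

  -- A colouring is charged u for every edge of the tree T and every sprinkled edge inside it, and y
  -- for every violated one among these; as u ^ k * y ≥ 1, it weighs at least 1 as soon as at most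
  -- one edge in k is violated.
  module Certificate {n} (G : Graph n) {xs} (T : Tree (λ u v → Joined {n} u v G) xs) {u y : ℚ} (1≤u : 1ℚ ≤ u) (0≤y : 0ℚ ≤ y) where

    0≤u : 0ℚ ≤ u
    0≤u = ≤-trans 0≤1 1≤u

    edgeWeight : Colouring xs → Fin n × Fin n → ℚ
    edgeWeight bs (i , j) = u ^ inside (partial xs bs i) (partial xs bs j) * y ^ mono (partial xs bs i) (partial xs bs j)

    edgeWeight-nonneg : ∀ bs e → 0ℚ ≤ edgeWeight bs e
    edgeWeight-nonneg bs (i , j) = *-nonneg (^-nonneg (inside (partial xs bs i) (partial xs bs j)) 0≤u)
      (^-nonneg (mono (partial xs bs i) (partial xs bs j)) 0≤y)

    treeWeight : Colouring xs → ℚ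
    treeWeight bs = u ^ length xs * y ^ violations T bs

    treeWeight-nonneg : ∀ bs → 0ℚ ≤ treeWeight bs
    treeWeight-nonneg bs = *-nonneg (^-nonneg (length xs) 0≤u) (^-nonneg (violations T bs) 0≤y)

    total : Graph n → Colouring xs → ℚ
    total H bs = treeWeight bs * ∏-on (edgeWeight bs) (pairs n) H

    total-nonneg : ∀ H bs → 0ℚ ≤ total H bs
    total-nonneg H bs = *-nonneg (treeWeight-nonneg bs) (∏-on-nonneg (edgeWeight-nonneg bs) (pairs n) H)

    certificate : ∀ {k} (H : Graph n) (σ : Family (suc k) n) → 1ℚ ≤ u ^ suc k * y →
      Separated σ (zipWith _∨_ G H) → ∃ λ bs → 1ℚ ≤ total H bs
    certificate {k} H σ 1≤uᵏy sep = All.universal (σ c) xs , (begin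
      1ℚ                                                       ≤⟨ ^-≥1 cost 1≤uᵏy ⟩
      (u ^ suc k * y) ^ cost                                   ≡⟨ ^-distrib-* (u ^ suc k) y cost ⟩
      (u ^ suc k) ^ cost * y ^ cost                            ≡⟨ cong₂ _*_ (sym (^-* u cost (suc k))) (^-+ y V M) ⟩
      u ^ (cost ℕ.* suc k) * (y ^ V * y ^ M)                   ≤⟨ *-monoˡ (*-nonneg (^-nonneg V 0≤y) (^-nonneg M 0≤y)) (^-monoʳ 1≤u bound) ⟩
      u ^ (length xs ℕ.+ I) * (y ^ V * y ^ M)                  ≡⟨ cong (_* (y ^ V * y ^ M)) (^-+ u (length xs) I) ⟩
      u ^ length xs * u ^ I * (y ^ V * y ^ M)                  ≡⟨ lem (u ^ length xs) (u ^ I) (y ^ V) (y ^ M) ⟩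
      u ^ length xs * y ^ V * (u ^ I * y ^ M)                  ≡⟨ cong (λ i → u ^ length xs * y ^ V * (u ^ i * y ^ M)) I≡ ⟨
      u ^ length xs * y ^ V * (u ^ I′ * y ^ M)                 ≡⟨ cong (_*_ (u ^ length xs * y ^ V)) (∏-on-powers u y
                                                                    (λ (i , j) → inside (κ c i) (κ c j)) (λ (i , j) → mono (κ c i) (κ c j)) (pairs n) H) ⟨
      total H (All.universal (σ c) xs)                         ∎)
      where
      open ≤-Reasoning
      κ : Fin (suc k) → PartialColouring n
      κ c = restrict xs (σ c)
      monos : Fin (suc k) → ℕ
      monos c = countOn (λ (i , j) → mono (κ c i) (κ c j)) (pairs n) H
      viols : Fin (suc k) → ℕ
      viols c = violations T (All.universal (σ c) xs)
      choice = pigeonhole (λ c → viols c ℕ.+ monos c)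
      c = proj₁ choice
      V = viols c
      M = monos c
      cost = V ℕ.+ M
      I = countOn (within xs) (pairs n) H
      I′ = countOn (λ (i , j) → inside (κ c i) (κ c j)) (pairs n) H
      I≡ : I′ ≡ I
      I≡ = countOn-cong (λ (i , j) → inside-restrict xs (σ c) i j) (pairs n) H
      sepH : All (λ e → sum (λ c → mono (κ c (proj₁ e)) (κ c (proj₂ e))) ℕ.≤ within xs e) (edges {n} H)
      sepH = All.map (λ {e} → ∑-mono-restrict xs σ e) (All-edgeList-∨ʳ {n} (pairs n) G H sep)
      sepT : ∀ {u w} → Joined u w G → monochromatic σ (u , w) ℕ.≤ 1
      sepT e = Separated-Adj {σ = σ} {zipWith _∨_ G H} sep (Joined⇒Adj {G = zipWith _∨_ G H} (Joined-∨ˡ G H e))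
      -- Summed over all `suc k` cuts, each tree edge and each sprinkled edge inside the tree is
      -- violated at most once; the cut chosen by pigeonhole carries at most an average share of
      -- that total.
      bound : cost ℕ.* suc k ℕ.≤ length xs ℕ.+ I
      bound = ℕₚ.≤-trans (ℕₚ.≤-reflexive (ℕₚ.*-comm cost (suc k))) (ℕₚ.≤-trans (proj₂ choice)
        (ℕₚ.≤-trans (ℕₚ.≤-reflexive (∑-distrib-+ viols monos))
          (ℕₚ.+-mono-≤ (∑-violations T σ sepT)
            (∑-countOn (λ c (i , j) → mono (κ c i) (κ c j)) (within xs) (pairs n) H sepH))))
      lem : ∀ a b c d → a * b * (c * d) ≡ a * c * (b * d)
      lem = solve-∀ ℚ-ring

    -- The union bound in Markov form: one colouring of weight at least 1 suffices, and all other
    -- weights are nonnegative.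
    indicator≤∑ᶜ : ∀ {k} → 1ℚ ≤ u ^ suc k * y → ∀ H →
      indicator (separable (suc k) n (zipWith _∨_ G H)) ≤ ∑ᶜ xs (total H)
    indicator≤∑ᶜ {k} 1≤uᵏy H = indicator-≤ (separable (suc k) n (zipWith _∨_ G H)) (∑ᶜ-nonneg xs (total-nonneg H)) λ eq →
      let σ , sep = separable⇒Separated (suc k) n {zipWith _∨_ G H} eq
          bs , 1≤ = certificate H σ 1≤uᵏy sep
      in ≤-trans 1≤ (term≤∑ᶜ xs (total-nonneg H) bs)

    module _ {p a b : ℚ} (0≤p : 0ℚ ≤ p) (p≤1 : p ≤ 1ℚ) (a≤1 : a ≤ 1ℚ) (1≤b : 1ℚ ≤ b)
      (mono≤a : 1ℚ - p + p * (u * y) ≤ a) (bichrom≤b : 1ℚ - p + p * u ≤ b)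
      (r : ℕ) (1≤r : 1 ℕ.≤ r) (8r≤ : 8 ℕ.* r ℕ.≤ length xs) (≤16r : length xs ℕ.≤ 16 ℕ.* r) where

      0≤a : 0ℚ ≤ a
      0≤a = ≤-trans (+-nonneg (gap p≤1) (*-nonneg 0≤p (*-nonneg 0≤u 0≤y))) mono≤a

      -- A pair reaching outside the tree has weight 1 and hence mean factor 1; the two kinds of
      -- pairs inside the tree are governed by `a` and `b`.
      factor≤ : ∀ bs e → 1ℚ - p + p * edgeWeight bs e ≤
        a ^ mono (partial xs bs (proj₁ e)) (partial xs bs (proj₂ e)) * b ^ bichrom (partial xs bs (proj₁ e)) (partial xs bs (proj₂ e))
      factor≤ bs (i , j) = go (partial xs bs i) (partial xs bs j)
        where
        lem₁ : ∀ p u y → 1ℚ - p + p * (u * 1ℚ * (y * 1ℚ)) ≡ 1ℚ - p + p * (u * y)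
        lem₁ = solve-∀ ℚ-ring
        lem₂ : ∀ p u → 1ℚ - p + p * (u * 1ℚ * 1ℚ) ≡ 1ℚ - p + p * u
        lem₂ = solve-∀ ℚ-ring
        lem₃ : ∀ p → 1ℚ - p + p * (1ℚ * 1ℚ) ≡ 1ℚ * 1ℚ
        lem₃ = solve-∀ ℚ-ring
        lem₄ : ∀ a → a ≡ a * 1ℚ * 1ℚ
        lem₄ = solve-∀ ℚ-ring
        lem₅ : ∀ b → b ≡ 1ℚ * (b * 1ℚ)
        lem₅ = solve-∀ ℚ-ring
        monoCase : 1ℚ - p + p * (u * 1ℚ * (y * 1ℚ)) ≤ a * 1ℚ * 1ℚ
        monoCase = subst₂ _≤_ (sym (lem₁ p u y)) (lem₄ a) mono≤a
        bichromCase : 1ℚ - p + p * (u * 1ℚ * 1ℚ) ≤ 1ℚ * (b * 1ℚ)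
        bichromCase = subst₂ _≤_ (sym (lem₂ p u)) (lem₅ b) bichrom≤b
        go : ∀ s t → 1ℚ - p + p * (u ^ inside s t * y ^ mono s t) ≤ a ^ mono s t * b ^ bichrom s t
        go (just true)  (just true)  = monoCase
        go (just false) (just false) = monoCase
        go (just true)  (just false) = bichromCase
        go (just false) (just true)  = bichromCase
        go (just _)     nothing      = ≤-reflexive (lem₃ p)
        go nothing      _            = ≤-reflexive (lem₃ p)

      perVertex : ℚ
      perVertex = a ^ r * b ^ (8 ℕ.* r)

      -- As `a ≤ 1 ≤ b`, only a lower bound on monochromatic pairs and an upper bound on bichromatic
      -- ones matter. Both are linear in the size of the tree, which makes the estimate uniform over
      -- colourings and a pure power.
      E-∏-on≤ : ∀ bs → E p (∏-on (edgeWeight bs) (pairs n)) ≤ perVertex ^ length xs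
      E-∏-on≤ bs = begin
        E p (∏-on (edgeWeight bs) (pairs n))
          ≡⟨ E-∏ p (edgeWeight bs) (pairs n) ⟩
        ∏ (λ e → 1ℚ - p + p * edgeWeight bs e) (pairs n)
          ≤⟨ ∏-mono (λ e → +-nonneg (gap p≤1) (*-nonneg 0≤p (edgeWeight-nonneg bs e))) (factor≤ bs) (pairs n) ⟩
        ∏ (λ e → a ^ mono (κ (proj₁ e)) (κ (proj₂ e)) * b ^ bichrom (κ (proj₁ e)) (κ (proj₂ e))) (pairs n)
          ≡⟨ ∏-powers a b (λ (i , j) → mono (κ i) (κ j)) (λ (i , j) → bichrom (κ i) (κ j)) (pairs n) ⟩
        a ^ monoPairs * b ^ bichromPairs
          ≤⟨ *-mono (^-nonneg monoPairs 0≤a) (^-nonneg (s ℕ.* (8 ℕ.* r)) (≤-trans 0≤1 1≤b))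
               (^-antiʳ 0≤a a≤1 (subst (λ s → s ℕ.* r ℕ.≤ monoPairs) size≡s (many-mono r 1≤r (subst (8 ℕ.* r ℕ.≤_) (sym size≡s) 8r≤))))
               (^-monoʳ 1≤b (subst (λ s → bichromPairs ℕ.≤ s ℕ.* (8 ℕ.* r)) size≡s (few-bichrom r (subst (ℕ._≤ 16 ℕ.* r) (sym size≡s) ≤16r)))) ⟩
        a ^ (s ℕ.* r) * b ^ (s ℕ.* (8 ℕ.* r))
          ≡⟨ cong₂ _*_ (^-* a s r) (^-* b s (8 ℕ.* r)) ⟩
        (a ^ r) ^ s * (b ^ (8 ℕ.* r)) ^ s
          ≡⟨ ^-distrib-* (a ^ r) (b ^ (8 ℕ.* r)) s ⟨
        perVertex ^ s ∎
        where
        open ≤-Reasoning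
        κ = partial xs bs
        open PairCounts κ using (monoPairs; bichromPairs; many-mono; few-bichrom)
        s = length xs
        size≡s : size κ ≡ s
        size≡s = size-partial T bs

      -- With the sprinkled part bounded uniformly, only the tree weights remain to be summed over
      -- colourings, and they contribute `1 + y` per vertex instead of 2.
      separable-unlikely : ∀ {k} → 1ℚ ≤ u ^ suc k * y →
        E p (λ H → indicator (separable (suc k) n (zipWith _∨_ G H))) ≤
        (1ℚ + 1ℚ) * (u * (1ℚ + y) * perVertex) ^ length xs
      separable-unlikely {k} 1≤uᵏy = begin
        E p (λ H → indicator (separable (suc k) n (zipWith _∨_ G H)))
          ≤⟨ E-mono 0≤p p≤1 (indicator≤∑ᶜ 1≤uᵏy) ⟩
        E p (λ H → ∑ᶜ xs (total H))
          ≡⟨ E-∑ᶜ xs p (λ bs H → total H bs) ⟩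
        ∑ᶜ xs (λ bs → E p (λ H → total H bs))
          ≡⟨ ∑ᶜ-cong xs (λ bs → E-* p (treeWeight bs) (∏-on (edgeWeight bs) (pairs n))) ⟩
        ∑ᶜ xs (λ bs → treeWeight bs * E p (∏-on (edgeWeight bs) (pairs n)))
          ≤⟨ ∑ᶜ-mono xs (λ bs → *-monoʳ (treeWeight-nonneg bs) (E-∏-on≤ bs)) ⟩
        ∑ᶜ xs (λ bs → treeWeight bs * perVertex ^ s)
          ≡⟨ ∑ᶜ-cong xs (λ bs → lem₁ (u ^ s) (y ^ violations T bs) (perVertex ^ s)) ⟩
        ∑ᶜ xs (λ bs → u ^ s * perVertex ^ s * y ^ violations T bs)
          ≡⟨ ∑ᶜ-* xs (u ^ s * perVertex ^ s) (λ bs → y ^ violations T bs) ⟩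
        u ^ s * perVertex ^ s * ∑ᶜ xs (λ bs → y ^ violations T bs)
          ≤⟨ *-monoʳ (*-nonneg (^-nonneg s 0≤u) (^-nonneg s 0≤perVertex)) (∑ᶜ-violations T 0≤y) ⟩
        u ^ s * perVertex ^ s * ((1ℚ + 1ℚ) * (1ℚ + y) ^ s)
          ≡⟨ lem₂ (u ^ s) (perVertex ^ s) ((1ℚ + y) ^ s) ⟩
        (1ℚ + 1ℚ) * (u ^ s * (1ℚ + y) ^ s * perVertex ^ s)
          ≡⟨ cong (λ z → (1ℚ + 1ℚ) * (z * perVertex ^ s)) (^-distrib-* u (1ℚ + y) s) ⟨
        (1ℚ + 1ℚ) * ((u * (1ℚ + y)) ^ s * perVertex ^ s)
          ≡⟨ cong (_*_ (1ℚ + 1ℚ)) (^-distrib-* (u * (1ℚ + y)) perVertex s) ⟨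
        (1ℚ + 1ℚ) * (u * (1ℚ + y) * perVertex) ^ s ∎
        where
        open ≤-Reasoning
        s = length xs
        0≤perVertex : 0ℚ ≤ perVertex
        0≤perVertex = *-nonneg (^-nonneg r 0≤a) (^-nonneg (8 ℕ.* r) (≤-trans 0≤1 1≤b))
        lem₁ : ∀ a b c → a * b * c ≡ a * c * b
        lem₁ = solve-∀ ℚ-ring
        lem₂ : ∀ a b c → a * b * ((1ℚ + 1ℚ) * c) ≡ (1ℚ + 1ℚ) * (a * c * b)
        lem₂ = solve-∀ ℚ-ring

  -- Exposing edges one at a time: exploration of components

  AllPairs-resp-↭ : ∀ {A : Set} {R : A → A → Set} → Symmetric R → ∀ {xs ys} → xs ↭ ys → AllPairs R xs → AllPairs R ys
  AllPairs-resp-↭ R-sym Perm.refl         ps = ps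
  AllPairs-resp-↭ R-sym (Perm.prep x π)   (px ∷ ps) = All-resp-↭ π px ∷ AllPairs-resp-↭ R-sym π ps
  AllPairs-resp-↭ R-sym (Perm.swap x y π) ((pxy ∷ px) ∷ py ∷ ps) =
    (R-sym pxy ∷ All-resp-↭ π py) ∷ All-resp-↭ π px ∷ AllPairs-resp-↭ R-sym π ps
  AllPairs-resp-↭ R-sym (Perm.trans π ρ)  ps = AllPairs-resp-↭ R-sym ρ (AllPairs-resp-↭ R-sym π ps)

  module Conditioning (n : ℕ) where

    -- The answers received so far are recorded by a map F that overwrites the
    -- queried slots; a and b are fresh if F does not touch the slot of {a , b}.
    Fresh : (Graph n → Graph n) → Fin n → Fin n → Set
    Fresh F a b = a ≢ b × (∀ i → Slot a b i → ∀ x → Vec.lookup (F x) i ≡ Vec.lookup x i)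

    Fresh-sym : ∀ F → Symmetric (Fresh F)
    Fresh-sym F (a≢b , p) = ≢-sym a≢b , λ i s → p i (Slot-sym s)

    -- The overwrite acts before `F`, so that `E-condition` applied to `f` after `F` produces
    -- exactly `f` after `answer F j b`. Freshness guarantees that the new bit survives `F`.
    answer : (Graph n → Graph n) → Fin (numPairs n) → Bool → Graph n → Graph n
    answer F j b x = F (x [ j ]≔ b)

    Fresh-answer : ∀ F {j b a c} → (∀ i → Slot a c i → i ≢ j) → Fresh F a c → Fresh (answer F j b) a c
    Fresh-answer F {j} {b} other (a≢c , p) = a≢c , λ i s x →
      trans (p i s (x [ j ]≔ b)) (Vecₚ.lookup∘update′ (other i s) x b)

    -- A slot containing `u` encodes no pair of vertices both different from `u`.
    Fresh-answer-avoiding : ∀ F {u w j b} → Slot u w j → ∀ {ys} → All (u ≢_) ys →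
      AllPairs (Fresh F) ys → AllPairs (Fresh (answer F j b)) ys
    Fresh-answer-avoiding F slot-j []        []        = []
    Fresh-answer-avoiding F {u} {w} {j} slot-j (u≢y ∷ us) (py ∷ ps) =
      All.zipWith (λ (u≢c , fr) → Fresh-answer F (other u≢c) fr) (us , py) ∷ Fresh-answer-avoiding F slot-j us ps
      where
      other : ∀ {c} → u ≢ c → ∀ i → Slot _ c i → i ≢ j
      other u≢c i s refl with Slot-unique s slot-j
      ... | inj₁ (y≡u , _) = u≢y (sym y≡u)
      ... | inj₂ (_ , c≡u) = u≢c (sym c≡u)

    Fresh-answer-same : ∀ F {u w j b} → Slot u w j → u ≢ w → ∀ {v} → w ≢ v → Fresh F u v → Fresh (answer F j b) u v
    Fresh-answer-same F {u} {w} {j} slot-j u≢w {v} w≢v = Fresh-answer F other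
      where
      other : ∀ i → Slot u v i → i ≢ j
      other i s refl with Slot-unique s slot-j
      ... | inj₁ (_ , v≡w) = w≢v (sym v≡w)
      ... | inj₂ (u≡w , _) = u≢w u≡w

    Known : (Graph n → Graph n) → Fin n → Fin n → Set
    Known F u v = ∀ x → Joined u v (F x)

    Known-answer : ∀ F {j b u v} → Known F u v → Known (answer F j b) u v
    Known-answer F {j} {b} known x = known (x [ j ]≔ b)

    answered : ∀ F {u w j} → Slot u w j → Fresh F u w → Known (answer F j true) u w
    answered F {j = j} s (_ , p) x = j , s , trans (p j s (x [ j ]≔ true)) (Vecₚ.lookup∘update j x true)

  -- Here `f` stands for the probability of the bad event after the second round, given the first.
  -- The exploration stops in one of two ways. Either `16 r` vertices are discovered; a component is
  -- only begun while fewer than `8 r` are explored, so the current one then has at least `8 r`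
  -- vertices and `f-tree` applies. Or a component closes with at least `8 r` vertices explored;
  -- then positive answers were too rare, and `stuck` makes the potential exceed 1.
  module Exploration {n : ℕ} (f : Graph n → ℚ) {p z γ δ₁ δ₂ : ℚ} (0≤p : 0ℚ ≤ p) (p≤1 : p ≤ 1ℚ)
    (0≤z : 0ℚ ≤ z) (z≤1 : z ≤ 1ℚ) (0≤γ : 0ℚ ≤ γ) (0≤δ₁ : 0ℚ ≤ δ₁) (r : ℕ) (1≤r : 1 ℕ.≤ r) (16r≤n : 16 ℕ.* r ℕ.≤ n)
    (γ-step : γ * (1ℚ - p + p * z) ^ (n ℕ.∸ 16 ℕ.* r) ≤ 1ℚ)
    (f≤1 : ∀ x → f x ≤ 1ℚ)
    (f-tree : ∀ x {xs} → Tree (λ u v → Joined {n} u v x) xs → 8 ℕ.* r ℕ.≤ length xs → length xs ℕ.≤ 16 ℕ.* r → f x ≤ δ₂)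
    (0≤δ₂ : 0ℚ ≤ δ₂)
    (stuck : ∀ found done → found ℕ.≤ done → 8 ℕ.* r ℕ.≤ done → 1ℚ ≤ δ₁ * (z ^ found * γ ^ done))
    where

    open Conditioning n

    q : ℚ
    q = 1ℚ - p + p * z

    0≤q : 0ℚ ≤ q
    0≤q = +-nonneg (gap p≤1) (*-nonneg 0≤p 0≤z)

    q≤1 : q ≤ 1ℚ
    q≤1 = ≤-by (p * (1ℚ - z)) (*-nonneg 0≤p (gap z≤1)) (lem p z)
      where
      lem : ∀ p z → 1ℚ - p + p * z + p * (1ℚ - z) ≡ 1ℚ
      lem = solve-∀ ℚ-ring

    -- Each vertex found by a positive query contributes z and each explored vertex γ; q is the
    -- expected factor of a single query, so that γ-step pays for exploring one vertex.
    Φ : ℕ → ℕ → ℕ → ℚ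
    Φ found done todo = δ₂ + δ₁ * (z ^ found * γ ^ done * q ^ todo)

    δ₂≤Φ : ∀ i j k → δ₂ ≤ Φ i j k
    δ₂≤Φ i j k = ≤-by _ (*-nonneg 0≤δ₁ (*-nonneg (*-nonneg (^-nonneg i 0≤z) (^-nonneg j 0≤γ)) (^-nonneg k 0≤q))) refl

    Bound : (Graph n → Graph n) → ℚ → Set
    Bound F φ = E p (λ x → f (F x)) ≤ φ

    -- The martingale step, read backwards: averaging the potential over the two answers restores
    -- precisely the factor `q` of the pending query.
    query : ∀ F j {found done todo} → Bound (answer F j true) (Φ (suc found) done todo) →
      Bound (answer F j false) (Φ found done todo) → Bound F (Φ found done (suc todo))
    query F j {found} {done} {todo} yes′ no′ = begin
      E p (λ x → f (F x))
        ≡⟨ E-condition p j (λ x → f (F x)) ⟩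
      p * E p (λ x → f (answer F j true x)) + (1ℚ - p) * E p (λ x → f (answer F j false x))
        ≤⟨ +-mono-≤ (*-monoʳ 0≤p yes′) (*-monoʳ (gap p≤1) no′) ⟩
      p * Φ (suc found) done todo + (1ℚ - p) * Φ found done todo
        ≡⟨ lem p z δ₁ δ₂ (z ^ found) (γ ^ done) (q ^ todo) ⟩
      Φ found done (suc todo) ∎
      where
      open ≤-Reasoning
      lem : ∀ p z d e a b c → p * (e + d * (z * a * b * c)) + (1ℚ - p) * (e + d * (a * b * c))
                            ≡ e + d * (a * b * ((1ℚ - p + p * z) * c))
      lem = solve-∀ ℚ-ring

    -- `base` counts the vertices discovered before the current component, `done`
    -- the fully explored ones other than the current vertex u.
    record Visit (F : Graph n → Graph n) (k : ℕ) (u : Fin n) (active todo kept xs : List (Fin n)) (found done base : ℕ) : Set where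
      constructor visit-inv
      field
        fresh   : AllPairs (Fresh F) (active ++ todo ++ kept)
        fresh-u : All (Fresh F u) todo
        u≢      : All (u ≢_) (active ++ todo ++ kept)
        tree    : Tree (Known F) xs
        u∈      : u ∈ xs
        active∈ : All (_∈ xs) active
        todo∉   : All (_∉ xs) todo
        kept∉   : All (_∉ xs) kept
        found≤  : found ℕ.≤ suc (done ℕ.+ length active)
        fuel    : length active ℕ.+ (length todo ℕ.+ length kept) ≡ k
        total   : suc (done ℕ.+ k) ≡ n
        comp    : base ℕ.+ length xs ≡ suc (done ℕ.+ length active)
        base<   : base ℕ.< 8 ℕ.* r
        small   : suc (done ℕ.+ length active) ℕ.< 16 ℕ.* r

    -- Only the pair of `w` with `u` is spent. The pairs of `w` with the other unexplored vertices
    -- stay fresh, so `w` waits in `kept` and may be discovered later.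
    reject : ∀ {F k u active w todo kept xs found done base j} → Slot u w j →
      Visit F k u active (w ∷ todo) kept xs found done base →
      Visit (answer F j false) k u active todo (w ∷ kept) xs found done base
    reject {F} {active = active} {w} {todo} {kept} slot-j (visit-inv fresh (fw ∷ fu) u≢ tree u∈ active∈ (w∉ ∷ todo∉) kept∉ found≤ fuel total comp base< small) =
      visit-inv
        (Fresh-answer-avoiding F slot-j u≢′ (AllPairs-resp-↭ (Fresh-sym F) move fresh))
        (All.zipWith (λ (w≢v , fr) → Fresh-answer-same F slot-j (proj₁ fw) w≢v fr) (w≢todo , fu))
        u≢′ (Tree-map (λ {u} {v} → Known-answer F {u = u} {v}) tree) u∈ active∈ todo∉ (w∉ ∷ kept∉) found≤
        (trans (cong (length active ℕ.+_) (ℕₚ.+-suc (length todo) (length kept))) fuel) total comp base< small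
      where
      move : active ++ w ∷ todo ++ kept ↭ active ++ todo ++ w ∷ kept
      move = ++⁺ˡ active (↭-sym (shift w todo kept))
      u≢′ = All-resp-↭ move u≢
      w≢todo : All (w ≢_) todo
      w≢todo = All.map proj₁ (Allₚ.++⁻ˡ todo (Allₚ.++⁻ʳ active
        (AllPairs.head (AllPairs-resp-↭ (Fresh-sym F) (shift w active (todo ++ kept)) fresh))))

    accept : ∀ {F k u active w todo kept xs found done base j} → Slot u w j →
      suc (suc (done ℕ.+ length active)) ℕ.< 16 ℕ.* r →
      Visit F k u active (w ∷ todo) kept xs found done base →
      Visit (answer F j true) k u (w ∷ active) todo kept (w ∷ xs) (suc found) done base
    accept {F} {u = u} {active} {w} {todo} {kept} {xs} {done = done} {base} slot-j small′ (visit-inv fresh (fw ∷ fu) u≢ tree u∈ active∈ (w∉ ∷ todo∉) kept∉ found≤ fuel total comp base< small) =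
      visit-inv
        (Fresh-answer-avoiding F slot-j u≢′ fresh′)
        (All.zipWith (λ (w≢v , fr) → Fresh-answer-same F slot-j (proj₁ fw) w≢v fr) (w≢todo , fu))
        u≢′ (grow (Tree-map (λ {u} {v} → Known-answer F {u = u} {v}) tree) u∈ w∉ (answered F slot-j fw)) (there u∈)
        (here refl ∷ All.map there active∈)
        (All.zipWith outside (w≢todo , todo∉)) (All.zipWith outside (w≢kept , kept∉))
        (ℕₚ.≤-trans (s≤s found≤) (ℕₚ.≤-reflexive (cong suc suc-active)))
        (trans (sym (ℕₚ.+-suc (length active) (length todo ℕ.+ length kept))) fuel) total
        (trans (ℕₚ.+-suc base (length xs)) (trans (cong suc comp) (cong suc suc-active))) base<
        (subst (ℕ._< 16 ℕ.* r) (cong suc suc-active) small′)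
      where
      suc-active : suc (done ℕ.+ length active) ≡ done ℕ.+ suc (length active)
      suc-active = sym (ℕₚ.+-suc done (length active))
      move = shift w active (todo ++ kept)
      u≢′ = All-resp-↭ move u≢
      fresh′ = AllPairs-resp-↭ (Fresh-sym F) move fresh
      w≢rest : All (w ≢_) (todo ++ kept)
      w≢rest = All.map proj₁ (Allₚ.++⁻ʳ active (AllPairs.head fresh′))
      w≢todo = Allₚ.++⁻ˡ todo w≢rest
      w≢kept = Allₚ.++⁻ʳ todo w≢rest
      outside : ∀ {v} → w ≢ v × v ∉ xs → v ∉ w ∷ xs
      outside (w≢v , v∉) (here v≡w) = w≢v (sym v≡w)
      outside (w≢v , v∉) (there v∈) = v∉ v∈

    -- The positive answer brings the number of discovered vertices to `16 r`. Fewer than `8 r` of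
    -- them precede the current component, whose tree therefore has a size between `8 r` and `16 r`.
    finish : ∀ {F k u active w todo kept xs found done base j} → Slot u w j →
      ¬ (suc (suc (done ℕ.+ length active)) ℕ.< 16 ℕ.* r) →
      Visit F k u active (w ∷ todo) kept xs found done base → Bound (answer F j true) δ₂
    finish {F} {active = active} {w} {xs = xs} {done = done} {base} {j} slot-j big v =
      subst (E p (λ x → f (answer F j true x)) ≤_) (E-const p (numPairs n) δ₂)
      (E-mono 0≤p p≤1 λ x → f-tree (answer F j true x)
        (grow (Tree-map (λ known → known (x [ j ]≔ true)) tree) u∈ (All.head todo∉) (answered F slot-j (All.head fresh-u) x))
        (ℕₚ.+-cancelˡ-≤ (8 ℕ.* r) _ _ (begin
          8 ℕ.* r ℕ.+ 8 ℕ.* r            ≡⟨ ℕₚ.*-distribʳ-+ r 8 8 ⟨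
          16 ℕ.* r                       ≤⟨ ℕₚ.≮⇒≥ big ⟩
          suc (suc (done ℕ.+ length active)) ≡⟨ cong suc comp ⟨
          suc (base ℕ.+ length xs)       ≡⟨ ℕₚ.+-suc base (length xs) ⟨
          base ℕ.+ suc (length xs)       ≤⟨ ℕₚ.+-monoˡ-≤ (suc (length xs)) (ℕₚ.<⇒≤ base<) ⟩
          8 ℕ.* r ℕ.+ suc (length xs)    ∎))
        (begin
          suc (length xs)                    ≤⟨ s≤s (ℕₚ.m≤n+m (length xs) base) ⟩
          suc (base ℕ.+ length xs)           ≡⟨ cong suc comp ⟩
          suc (suc (done ℕ.+ length active)) ≤⟨ small ⟩
          16 ℕ.* r                           ∎))
      where
      open Visit v
      open ℕₚ.≤-Reasoning

    process : ∀ k F u active todo kept xs {found done base} → Visit F k u active todo kept xs found done base →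
      Bound F (Φ found (suc done) (length todo))
    enter : ∀ k F u active todo xs {found done base} → Visit F k u active todo [] xs found done base →
      Bound F (Φ found done 0)
    resume : ∀ k F active unseen xs {found done base} →
      AllPairs (Fresh F) (active ++ unseen) → Tree (Known F) xs → All (_∈ xs) active → All (_∉ xs) unseen →
      found ℕ.≤ done ℕ.+ length active → length active ℕ.+ length unseen ≡ k → done ℕ.+ k ≡ n →
      base ℕ.+ length xs ≡ done ℕ.+ length active → base ℕ.< 8 ℕ.* r → done ℕ.+ length active ℕ.< 16 ℕ.* r →
      Bound F (Φ found done 0)
    restart : ∀ k F unseen {found done} → AllPairs (Fresh F) unseen → found ℕ.≤ done →
      length unseen ≡ k → done ℕ.+ k ≡ n → done ℕ.< 16 ℕ.* r → Bound F (Φ found done 0)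

    process k F u active [] kept xs {found} {done} (visit-inv fresh _ u≢ tree u∈ active∈ _ kept∉ found≤ fuel total comp base< small) =
      resume k F active kept xs fresh tree active∈ kept∉ found≤ fuel total comp base< small
    process k F u active (w ∷ todo) kept xs {found} {done} v with slot (proj₁ (All.head (Visit.fresh-u v)))
    ... | j , slot-j = query F j {found} {suc done} {length todo} positive (process k (answer F j false) u active todo (w ∷ kept) xs (reject slot-j v))
      where
      positive : Bound (answer F j true) (Φ (suc found) (suc done) (length todo))
      positive with suc (suc (done ℕ.+ length active)) ℕ.<? 16 ℕ.* r
      ... | yes small′ = process k (answer F j true) u (w ∷ active) todo kept (w ∷ xs) (accept slot-j small′ v)
      ... | no big     = ≤-trans (finish slot-j big v) (δ₂≤Φ (suc found) (suc done) (length todo))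

    -- Fewer than `16 r` vertices are discovered at this point, so at least `n - 16 r` queries lie
    -- ahead, and by `γ-step` their factors `q` pay for the advance charge `γ`.
    enter k F u active todo xs {found} {done} v = ≤-trans (process k F u active todo [] xs v)
      (+-monoʳ-≤ δ₂ (*-monoʳ 0≤δ₁ (begin
        z ^ found * (γ * γ ^ done) * q ^ length todo
          ≤⟨ *-monoʳ (*-nonneg (^-nonneg found 0≤z) (*-nonneg 0≤γ (^-nonneg done 0≤γ))) (^-antiʳ 0≤q q≤1 many) ⟩
        z ^ found * (γ * γ ^ done) * q ^ (n ℕ.∸ 16 ℕ.* r)
          ≡⟨ lem (z ^ found) γ (γ ^ done) (q ^ (n ℕ.∸ 16 ℕ.* r)) ⟩
        z ^ found * γ ^ done * (γ * q ^ (n ℕ.∸ 16 ℕ.* r))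
          ≤⟨ *-monoʳ (*-nonneg (^-nonneg found 0≤z) (^-nonneg done 0≤γ)) γ-step ⟩
        z ^ found * γ ^ done * 1ℚ ∎)))
      where
      open ≤-Reasoning
      open Visit v using (fuel; total; small)
      lem : ∀ a g b c → a * (g * b) * c ≡ a * b * (g * c)
      lem = solve-∀ ℚ-ring
      n≡ : n ≡ suc (done ℕ.+ length active) ℕ.+ length todo
      n≡ = trans (sym total) (trans (cong (λ k → suc (done ℕ.+ k)) (trans (sym fuel)
        (cong (length active ℕ.+_) (ℕₚ.+-identityʳ (length todo))))) (cong suc (sym (ℕₚ.+-assoc done (length active) (length todo)))))
      many : n ℕ.∸ 16 ℕ.* r ℕ.≤ length todo
      many = ℕₚ.m≤n+o⇒m∸n≤o n (16 ℕ.* r) (ℕₚ.≤-trans (ℕₚ.≤-reflexive n≡) (ℕₚ.+-monoˡ-≤ (length todo) (ℕₚ.<⇒≤ small)))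

    resume k F [] unseen xs {found} {done} fresh tree _ _ found≤ fuel total comp base< small =
      restart k F unseen fresh (subst (found ℕ.≤_) (ℕₚ.+-identityʳ done) found≤) fuel total
        (subst (ℕ._< 16 ℕ.* r) (ℕₚ.+-identityʳ done) small)
    resume (suc k) F (u ∷ active) unseen xs {found} {done} (pu ∷ fresh) tree (u∈ ∷ active∈) unseen∉ found≤ fuel total comp base< small =
      enter k F u active unseen xs (visit-inv
        (subst (λ l → AllPairs (Fresh F) (active ++ l)) (sym (Listₚ.++-identityʳ unseen)) fresh)
        (Allₚ.++⁻ʳ active pu)
        (subst (λ l → All (u ≢_) (active ++ l)) (sym (Listₚ.++-identityʳ unseen)) (All.map proj₁ pu))
        tree u∈ active∈ unseen∉ []
        (subst (found ℕ.≤_) (ℕₚ.+-suc done (length active)) found≤)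
        (trans (cong (length active ℕ.+_) (ℕₚ.+-identityʳ (length unseen))) (ℕₚ.suc-injective fuel))
        (trans (sym (ℕₚ.+-suc done k)) total)
        (trans comp (ℕₚ.+-suc done (length active))) base<
        (subst (ℕ._< 16 ℕ.* r) (ℕₚ.+-suc done (length active)) small))

    restart k F unseen {found} {done} fresh found≤ fuel total small with 8 ℕ.* r ℕ.≤? done
    -- The potential is already at least 1, so the trivial bound on `f` is enough.
    ... | yes 8r≤done = ≤-trans (subst (E p (λ x → f (F x)) ≤_) (E-const p (numPairs n) 1ℚ) (E-mono 0≤p p≤1 (λ x → f≤1 (F x))))
      (≤-trans (stuck found done found≤ 8r≤done) (≤-by δ₂ 0≤δ₂ (lem δ₁ δ₂ (z ^ found * γ ^ done))))
      where
      lem : ∀ d e a → d * a + e ≡ e + d * (a * 1ℚ)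
      lem = solve-∀ ℚ-ring
    -- Running out of vertices would mean `done = n`, which is at least `16 r`.
    restart zero    F []          {done = done} fresh found≤ fuel total small | no _ =
      contradiction (ℕₚ.<-≤-trans small 16r≤n) (ℕₚ.<-irrefl (trans (sym (ℕₚ.+-identityʳ done)) total))
    restart (suc k) F (u ∷ unseen) {found} {done} (pu ∷ fresh) found≤ fuel total small | no 8r≰done =
      -- A new root is discovered without a positive answer, so `found` may lag behind the number of
      -- discovered vertices. Nothing is active, so `base` is `done`.
      enter k F u [] unseen (u ∷ []) {base = done} (visit-inv
        (subst (AllPairs (Fresh F)) (sym (Listₚ.++-identityʳ unseen)) fresh)
        pu
        (subst (All (u ≢_)) (sym (Listₚ.++-identityʳ unseen)) (All.map proj₁ pu))
        (root u) (here refl) []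
        (All.map (λ (u≢v , _) → λ where (here v≡u) → u≢v (sym v≡u)) pu) []
        (ℕₚ.≤-trans found≤ (ℕₚ.≤-trans (ℕₚ.n≤1+n done) (s≤s (ℕₚ.≤-reflexive (sym (ℕₚ.+-identityʳ done))))))
        (trans (ℕₚ.+-identityʳ (length unseen)) (ℕₚ.suc-injective fuel))
        (trans (sym (ℕₚ.+-suc done k)) total)
        (ℕₚ.+-suc done 0) (ℕₚ.≰⇒> 8r≰done)
        (subst (λ d → suc d ℕ.< 16 ℕ.* r) (sym (ℕₚ.+-identityʳ done))
          (ℕₚ.≤-<-trans (ℕₚ.≰⇒> 8r≰done) (ℕₚ.*-monoˡ-< r {{ℕ.>-nonZero 1≤r}} (ℕₚ.m<m+n 8 {8} (s≤s z≤n))))))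

    E≤ : E p f ≤ δ₂ + δ₁
    E≤ = subst (E p f ≤_) (lem δ₁ δ₂)
      (restart n (λ x → x) (allFin n) {0} {0} (AllPairs.map (λ a≢b → a≢b , λ _ _ _ → refl) (Uniqueₚ.allFin⁺ n)) z≤n
        (Listₚ.length-tabulate (λ x → x)) refl (ℕₚ.<-≤-trans (s≤s z≤n) (ℕₚ.*-monoʳ-≤ 16 1≤r)))
      where
      lem : ∀ d e → e + d * (1ℚ * 1ℚ * 1ℚ) ≡ e + d
      lem = solve-∀ ℚ-ring

  -- Meant for numerals: it normalises at once, where `⟦ 1024 ⟧` would unfold into 1024 additions.
  -- `/1≡⟦⟧` translates between the two casts.
  # : ℕ → ℚ
  # k = + k / 1

  #-nonneg : ∀ k → 0ℚ ≤ # k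
  #-nonneg k = subst (0ℚ ≤_) (sym (/1≡⟦⟧ k)) (⟦⟧-nonneg k)

  reciprocal : ∀ {p} → 0ℚ < p → ∃ λ v → 0ℚ < v × p * v ≡ 1ℚ
  reciprocal {p} 0<p = (ℚ.1/ p) {{nz}} , positive⁻¹ _ {{1/pos⇒pos p {{ps}}}} , *-inverseʳ p {{nz}}
    where
    ps = ℚ.positive 0<p
    nz = pos⇒nonZero p {{ps}}

  ≤⟦⟧ : ∀ p → 0ℚ < p → ∃ λ k → p ≤ ⟦ k ⟧
  ≤⟦⟧ p 0<p =
    let v , 0<v , pv≡1 = reciprocal 0<p
        k , 1≤kv = archimedean v 0<v
    in k , subst₂ _≤_ (*-identityʳ p)
             (trans (lem p ⟦ k ⟧ v) (trans (cong (_*_ ⟦ k ⟧) pv≡1) (*-identityʳ ⟦ k ⟧)))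
             (*-monoʳ (<⇒≤ 0<p) 1≤kv)
    where
    lem : ∀ p k v → p * (k * v) ≡ k * (p * v)
    lem = solve-∀ ℚ-ring

  -- Yields the reciprocal rounded up. The first bound makes the scale `c` small enough, the second
  -- keeps the threshold of order `1 / ε³`.
  least-multiple : ∀ p k → 1ℚ ≤ ⟦ k ⟧ * p → ∃ λ j → 1ℚ ≤ ⟦ suc j ⟧ * p × ⟦ j ⟧ * p ≤ 1ℚ
  least-multiple p zero    1≤0p = contradiction (<-≤-trans 0<1 (subst (1ℚ ≤_) (*-zeroˡ p) 1≤0p)) (<-irrefl refl)
  least-multiple p (suc k) 1≤kp with 1ℚ ≤? ⟦ k ⟧ * p
  ... | yes 1≤    = least-multiple p k 1≤
  ... | no  1≰    = k , 1≤kp , <⇒≤ (≰⇒> 1≰)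

  -- Polynomial inequalities in the scale `c`

  module Inequalities {c : ℚ} (0≤c : 0ℚ ≤ c) (256c≤1 : # 256 * c ≤ 1ℚ) where

    t : 0ℚ ≤ 1ℚ - # 256 * c
    t = gap 256c≤1

    0≤c² : 0ℚ ≤ c * c
    0≤c² = *-nonneg 0≤c 0≤c

    #c : ∀ k → 0ℚ ≤ # k * c
    #c k = *-nonneg (#-nonneg k) 0≤c

    32c≤1 : # 32 * c ≤ 1ℚ
    32c≤1 = ≤-by (1ℚ - # 256 * c + # 224 * c) (+-nonneg t (#c 224)) (lem c)
      where
      lem : ∀ c → # 32 * c + (1ℚ - # 256 * c + # 224 * c) ≡ 1ℚ
      lem = solve-∀ ℚ-ring

    64c≤½ : # 64 * c ≤ ℚ.½
    64c≤½ = ≤-by (ℚ.½ * (1ℚ - # 256 * c + # 128 * c)) (*-nonneg (#½) (+-nonneg t (#c 128))) (lem c)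
      where
      #½ : 0ℚ ≤ ℚ.½
      #½ = nonNegative⁻¹ ℚ.½
      lem : ∀ c → # 64 * c + ℚ.½ * (1ℚ - # 256 * c + # 128 * c) ≡ ℚ.½
      lem = solve-∀ ℚ-ring

    1024c²≤1 : # 1024 * (c * c) ≤ 1ℚ
    1024c²≤1 = ≤-by (# 4 * c * (1ℚ - # 256 * c) + (1ℚ - # 256 * c + # 252 * c))
      (+-nonneg (*-nonneg (#c 4) t) (+-nonneg t (#c 252))) (lem c)
      where
      lem : ∀ c → # 1024 * (c * c) + (# 4 * c * (1ℚ - # 256 * c) + (1ℚ - # 256 * c + # 252 * c)) ≡ 1ℚ
      lem = solve-∀ ℚ-ring

    -- Here `1 - 16 x` is the fraction of vertices outside a set of `16 r`, and `(1 + 192 c) / n` a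
    -- lower bound for the first-round probability: the exploration stays supercritical throughout.
    drift : ∀ {x} → x ≤ c → 1ℚ + # 128 * c ≤ (1ℚ - # 16 * x) * (1ℚ + # 192 * c)
    drift {x} x≤c = ≤-by
      (# 16 * (c - x) * (1ℚ + # 192 * c) + # 48 * c * (1ℚ - # 256 * c + # 192 * c))
      (+-nonneg (*-nonneg (*-nonneg (#-nonneg 16) (gap x≤c)) (+-nonneg 0≤1 (#c 192)))
                (*-nonneg (#c 48) (+-nonneg t (#c 192))))
      (lem c x)
      where
      lem : ∀ c x → 1ℚ + # 128 * c + (# 16 * (c - x) * (1ℚ + # 192 * c) + # 48 * c * (1ℚ - # 256 * c + # 192 * c))
                  ≡ (1ℚ - # 16 * x) * (1ℚ + # 192 * c)
      lem = solve-∀ ℚ-ring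

    -- For `μ = 1 + 128 c` the linear terms cancel and c² has coefficient
    -- `32 * 128 - 32 * 32 = 3072`; the cubic term takes away at most `512 c²` since `256 c ≤ 1`.
    -- This leaves far more than the required 8.
    explored-growth : ∀ {μ} → 1ℚ + # 128 * c ≤ μ → 1ℚ + # 8 * (c * c) ≤ (1ℚ - # 32 * c) * (1ℚ + # 32 * c * μ)
    explored-growth {μ} ≤μ = ≤-by
      (c * c * (# 512 * (1ℚ - # 256 * c) + # 2552) + (1ℚ - # 32 * c) * (# 32 * c) * (μ - (1ℚ + # 128 * c)))
      (+-nonneg (*-nonneg 0≤c² (+-nonneg (*-nonneg (#-nonneg 512) t) (#-nonneg 2552)))
                (*-nonneg (*-nonneg (gap 32c≤1) (#c 32)) (gap ≤μ)))
      (lem c μ)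
      where
      lem : ∀ c μ → 1ℚ + # 8 * (c * c) + (c * c * (# 512 * (1ℚ - # 256 * c) + # 2552)
                      + (1ℚ - # 32 * c) * (# 32 * c) * (μ - (1ℚ + # 128 * c)))
                  ≡ (1ℚ - # 32 * c) * (1ℚ + # 32 * c * μ)
      lem = solve-∀ ℚ-ring

    -- The budget per tree vertex. To first order in c², the charges `u` and `1 + y` and the desired
    -- gain take `1 + 1 + 8`, against 16 from monochromatic pairs; bichromatic pairs only matter at
    -- order c⁴.
    balance : (1ℚ + c * c) * (1ℚ + c * c) * (1ℚ + # 8 * (c * c)) ≤ (1ℚ + # 16 * (c * c)) * (1ℚ - # 512 * (c * c * (c * c)))
    balance = ≤-by (w * (g + # 9 * w * g + # 5 + # 486 * w + # 1016 * w * w))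
      (*-nonneg 0≤c² (+-nonneg (+-nonneg (+-nonneg (+-nonneg 0≤g (*-nonneg (*-nonneg (#-nonneg 9) 0≤c²) 0≤g)) (#-nonneg 5))
        (*-nonneg (#-nonneg 486) 0≤c²)) (*-nonneg (*-nonneg (#-nonneg 1016) 0≤c²) 0≤c²)))
      (lem w)
      where
      w = c * c
      g = 1ℚ - # 1024 * w
      0≤g = gap 1024c²≤1
      lem : ∀ w → (1ℚ + w) * (1ℚ + w) * (1ℚ + # 8 * w)
                  + w * ((1ℚ - # 1024 * w) + # 9 * w * (1ℚ - # 1024 * w) + # 5 + # 486 * w + # 1016 * w * w)
                ≡ (1ℚ + # 16 * w) * (1ℚ - # 512 * (w * w))
      lem = solve-∀ ℚ-ring

    -- A monochromatic sprinkled edge weighs `u * y`, which is below one half, so at least half of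
    -- `p₂` is gained.
    mono-factor : ∀ {ι} → 0ℚ ≤ ι →
      1ℚ - # 64 * c * ι + # 64 * c * ι * ((1ℚ + c * c) * (c * c)) ≤ 1ℚ - # 32 * c * ι
    mono-factor {ι} 0≤ι = ≤-by (# 32 * c * ι * (g + w * (# 1020 + # 2 * (g + # 1023 * w))))
      (*-nonneg (*-nonneg (#c 32) 0≤ι) (+-nonneg 0≤g (*-nonneg 0≤c² (+-nonneg (#-nonneg 1020)
        (*-nonneg (#-nonneg 2) (+-nonneg 0≤g (*-nonneg (#-nonneg 1023) 0≤c²)))))))
      (lem c ι w)
      where
      w = c * c
      g = 1ℚ - # 1024 * w
      0≤g = gap 1024c²≤1
      lem : ∀ c ι w → 1ℚ - # 64 * c * ι + # 64 * c * ι * ((1ℚ + w) * w)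
          + # 32 * c * ι * ((1ℚ - # 1024 * w) + w * (# 1020 + # 2 * ((1ℚ - # 1024 * w) + # 1023 * w)))
          ≡ 1ℚ - # 32 * c * ι
      lem = solve-∀ ℚ-ring

  -- The scale is c = 1/Q, of order ε; the tree found in the first round has between 8r and
  -- 16r vertices, where r is n/Q rounded down, so that r/n lies between c/2 and c.
  module Sprinkling {ε c : ℚ} {Q n′ r : ℕ} (0≤c : 0ℚ ≤ c) (256c≤1 : # 256 * c ≤ 1ℚ) (256c≤ε : # 256 * c ≤ ε)
    (Qc≡1 : ⟦ Q ⟧ * c ≡ 1ℚ) (1≤r : 1 ℕ.≤ r) (Qr≤n : Q ℕ.* r ℕ.≤ suc n′) (n≤2Qr : suc n′ ℕ.≤ Q ℕ.* (r ℕ.+ r))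
    (16r≤n : 16 ℕ.* r ℕ.≤ suc n′) (1+ε≤n : 1ℚ + ε ≤ ⟦ suc n′ ⟧)
    {δ : ℚ} (0≤δ : 0ℚ ≤ δ) (large-r : # 2 ≤ δ * (⟦ 8 ℕ.* r ⟧ * (# 8 * (c * c)))) where

    n = suc n′
    open Inequalities 0≤c 256c≤1

    ι x p p₂ : ℚ
    ι = + 1 / suc n′
    x = ⟦ r ⟧ * ι
    p = (1ℚ + ε) * ι
    p₂ = # 64 * c * ι

    nι≡1 : ⟦ n ⟧ * ι ≡ 1ℚ
    nι≡1 = 1/-inverse n′

    0≤ι : 0ℚ ≤ ι
    0≤ι = *-cancel (⟦⟧-pos n′) (subst₂ _≤_ (sym (*-zeroʳ ⟦ n ⟧)) (sym nι≡1) 0≤1)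

    ι≤1 : ι ≤ 1ℚ
    ι≤1 = subst₂ _≤_ (*-identityˡ ι) nι≡1 (*-monoˡ {1ℚ} {⟦ n ⟧} 0≤ι (≤-by {1ℚ} ⟦ n′ ⟧ (⟦⟧-nonneg n′) refl))

    x≤c : x ≤ c
    x≤c = begin
      ⟦ r ⟧ * ι                    ≡⟨ *-identityʳ x ⟨
      ⟦ r ⟧ * ι * 1ℚ               ≡⟨ cong (_*_ x) Qc≡1 ⟨
      ⟦ r ⟧ * ι * (⟦ Q ⟧ * c)      ≡⟨ lem ⟦ r ⟧ ι ⟦ Q ⟧ c ⟩
      ⟦ Q ⟧ * ⟦ r ⟧ * (ι * c)      ≡⟨ cong (_* (ι * c)) (⟦⟧-* Q r) ⟨
      ⟦ Q ℕ.* r ⟧ * (ι * c)        ≤⟨ *-monoˡ (*-nonneg 0≤ι 0≤c) (⟦⟧-mono Qr≤n) ⟩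
      ⟦ n ⟧ * (ι * c)              ≡⟨ *-assoc ⟦ n ⟧ ι c ⟨
      ⟦ n ⟧ * ι * c                ≡⟨ cong (_* c) nι≡1 ⟩
      1ℚ * c                       ≡⟨ *-identityˡ c ⟩
      c                            ∎
      where
      open ≤-Reasoning
      lem : ∀ r ι Q c → r * ι * (Q * c) ≡ Q * r * (ι * c)
      lem = solve-∀ ℚ-ring

    c≤2x : c ≤ x + x
    c≤2x = begin
      c                                ≡⟨ *-identityˡ c ⟨
      1ℚ * c                           ≡⟨ cong (_* c) nι≡1 ⟨
      ⟦ n ⟧ * ι * c                    ≡⟨ *-assoc ⟦ n ⟧ ι c ⟩
      ⟦ n ⟧ * (ι * c)                  ≤⟨ *-monoˡ (*-nonneg 0≤ι 0≤c) (⟦⟧-mono n≤2Qr) ⟩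
      ⟦ Q ℕ.* (r ℕ.+ r) ⟧ * (ι * c)    ≡⟨ cong (_* (ι * c)) (trans (⟦⟧-* Q (r ℕ.+ r)) (cong (_*_ ⟦ Q ⟧) (⟦⟧-+ r r))) ⟩
      ⟦ Q ⟧ * (⟦ r ⟧ + ⟦ r ⟧) * (ι * c) ≡⟨ lem ⟦ r ⟧ ι ⟦ Q ⟧ c ⟩
      ⟦ Q ⟧ * c * (x + x)              ≡⟨ cong (_* (x + x)) Qc≡1 ⟩
      1ℚ * (x + x)                     ≡⟨ *-identityˡ (x + x) ⟩
      x + x                            ∎
      where
      open ≤-Reasoning
      lem : ∀ r ι Q c → Q * (r + r) * (ι * c) ≡ Q * c * (r * ι + r * ι)
      lem = solve-∀ ℚ-ring

    p≤1 : p ≤ 1ℚ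
    p≤1 = subst (p ≤_) nι≡1 (*-monoˡ 0≤ι 1+ε≤n)

    0≤p₂ : 0ℚ ≤ p₂
    0≤p₂ = *-nonneg (#c 64) 0≤ι

    p₂≤½ : p₂ ≤ ℚ.½
    p₂≤½ = ≤-trans (subst (p₂ ≤_) (*-identityʳ (# 64 * c)) (*-monoʳ (#c 64) ι≤1)) 64c≤½

    p₂≤1 : p₂ ≤ 1ℚ
    p₂≤1 = ≤-trans p₂≤½ (≤-by ℚ.½ (nonNegative⁻¹ ℚ.½) refl)

    0<1-p₂ : 0ℚ < 1ℚ - p₂
    0<1-p₂ = <-≤-trans (positive⁻¹ ℚ.½) (≤-by (ℚ.½ - p₂) (gap p₂≤½) (lem p₂))
      where
      lem : ∀ p → ℚ.½ + (ℚ.½ - p) ≡ 1ℚ - p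
      lem = solve-∀ ℚ-ring

    v p₁ : ℚ
    v = proj₁ (reciprocal 0<1-p₂)
    p₁ = (p - p₂) * v

    0≤v : 0ℚ ≤ v
    0≤v = <⇒≤ (proj₁ (proj₂ (reciprocal 0<1-p₂)))

    v-inverse : (1ℚ - p₂) * v ≡ 1ℚ
    v-inverse = proj₂ (proj₂ (reciprocal 0<1-p₂))

    -- Of the surplus `ε ≥ 256 c`, the sprinkling takes `64 c`, which leaves at least `192 c` for
    -- the first round.
    p-p₂≥ : (1ℚ + # 192 * c) * ι ≤ p - p₂
    p-p₂≥ = ≤-by ((ε - # 256 * c) * ι) (*-nonneg (gap 256c≤ε) 0≤ι) (lem ε c ι)
      where
      lem : ∀ ε c ι → (1ℚ + # 192 * c) * ι + (ε - # 256 * c) * ι ≡ (1ℚ + ε) * ι - # 64 * c * ι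
      lem = solve-∀ ℚ-ring

    0≤p-p₂ : 0ℚ ≤ p - p₂
    0≤p-p₂ = ≤-trans (*-nonneg (+-nonneg 0≤1 (#c 192)) 0≤ι) p-p₂≥

    0≤p₁ : 0ℚ ≤ p₁
    0≤p₁ = *-nonneg 0≤p-p₂ 0≤v

    p₁≤1 : p₁ ≤ 1ℚ
    p₁≤1 = subst (p₁ ≤_) v-inverse (*-monoˡ 0≤v (+-monoˡ-≤ (- p₂) p≤1))

    p₁≥ : (1ℚ + # 192 * c) * ι ≤ p₁
    p₁≥ = ≤-trans p-p₂≥ (≤-by ((p - p₂) * p₂ * v) (*-nonneg (*-nonneg 0≤p-p₂ 0≤p₂) 0≤v)
      (trans (cong (_+ (p - p₂) * p₂ * v) (trans (sym (*-identityʳ (p - p₂))) (cong (_*_ (p - p₂)) (sym v-inverse))))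
             (lem (p - p₂) p₂ v)))
      where
      lem : ∀ d p v → d * ((1ℚ - p) * v) + d * p * v ≡ d * v
      lem = solve-∀ ℚ-ring

    two-rounds : 1ℚ - p ≡ (1ℚ - p₁) * (1ℚ - p₂)
    two-rounds = trans (lem₁ p p₂) (trans (cong (λ a → 1ℚ - p₂ - (p - p₂) * a) (sym v-inverse)) (lem₂ p p₂ v))
      where
      lem₁ : ∀ p q → 1ℚ - p ≡ 1ℚ - q - (p - q) * 1ℚ
      lem₁ = solve-∀ ℚ-ring
      lem₂ : ∀ p q v → 1ℚ - q - (p - q) * ((1ℚ - q) * v) ≡ (1ℚ - (p - q) * v) * (1ℚ - q)
      lem₂ = solve-∀ ℚ-ring

    -- First round: the exploration of G(n , p₁).

    m : ℕ
    m = n ℕ.∸ 16 ℕ.* r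

    mι≡ : ⟦ m ⟧ * ι ≡ 1ℚ - # 16 * x
    mι≡ = begin
      ⟦ m ⟧ * ι                                  ≡⟨ lem₁ ⟦ m ⟧ (# 16) ⟦ r ⟧ ι ⟩
      (⟦ m ⟧ + # 16 * ⟦ r ⟧) * ι - # 16 * x      ≡⟨ cong (λ a → (⟦ m ⟧ + a * ⟦ r ⟧) * ι - # 16 * x) (/1≡⟦⟧ 16) ⟩
      (⟦ m ⟧ + ⟦ 16 ⟧ * ⟦ r ⟧) * ι - # 16 * x    ≡⟨ cong (λ a → (⟦ m ⟧ + a) * ι - # 16 * x) (⟦⟧-* 16 r) ⟨
      (⟦ m ⟧ + ⟦ 16 ℕ.* r ⟧) * ι - # 16 * x      ≡⟨ cong (λ a → a * ι - # 16 * x) (⟦⟧-+ m (16 ℕ.* r)) ⟨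
      ⟦ m ℕ.+ 16 ℕ.* r ⟧ * ι - # 16 * x          ≡⟨ cong (λ a → ⟦ a ⟧ * ι - # 16 * x) (ℕₚ.m∸n+n≡m 16r≤n) ⟩
      ⟦ n ⟧ * ι - # 16 * x                       ≡⟨ cong (_- # 16 * x) nι≡1 ⟩
      1ℚ - # 16 * x                              ∎
      where
      open ≡-Reasoning
      lem₁ : ∀ m s r ι → m * ι ≡ (m + s * r) * ι - s * (r * ι)
      lem₁ = solve-∀ ℚ-ring

    -- `μ` bounds from below the mean number of vertices found from one vertex. With `h = 32 c`, the
    -- choice `z = 1 - h` and `γ = 1 + h μ` makes `γ-step` an exact instance of `bernoulli-decay`.
    μ z γ : ℚ
    μ = ⟦ m ⟧ * p₁
    z = 1ℚ - # 32 * c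
    γ = 1ℚ + # 32 * c * μ

    μ≥ : 1ℚ + # 128 * c ≤ μ
    μ≥ = begin
      1ℚ + # 128 * c                      ≤⟨ drift x≤c ⟩
      (1ℚ - # 16 * x) * (1ℚ + # 192 * c)  ≡⟨ cong (_* (1ℚ + # 192 * c)) mι≡ ⟨
      ⟦ m ⟧ * ι * (1ℚ + # 192 * c)        ≡⟨ lem ⟦ m ⟧ ι (1ℚ + # 192 * c) ⟩
      ⟦ m ⟧ * ((1ℚ + # 192 * c) * ι)      ≤⟨ *-monoʳ (⟦⟧-nonneg m) p₁≥ ⟩
      μ                                   ∎
      where
      open ≤-Reasoning
      lem : ∀ m ι a → m * ι * a ≡ m * (a * ι)
      lem = solve-∀ ℚ-ring

    0≤z : 0ℚ ≤ z
    0≤z = gap 32c≤1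

    z≤1 : z ≤ 1ℚ
    z≤1 = ≤-by (# 32 * c) (#c 32) (lem (# 32 * c))
      where
      lem : ∀ a → 1ℚ - a + a ≡ 1ℚ
      lem = solve-∀ ℚ-ring

    0≤γ : 0ℚ ≤ γ
    0≤γ = +-nonneg 0≤1 (*-nonneg (#c 32) (*-nonneg (⟦⟧-nonneg m) 0≤p₁))

    γ-step : γ * (1ℚ - p₁ + p₁ * z) ^ m ≤ 1ℚ
    γ-step = begin
      γ * (1ℚ - p₁ + p₁ * z) ^ m                    ≡⟨ cong₂ (λ a b → a * b ^ m) (lem₁ (# 32 * c) ⟦ m ⟧ p₁) (lem₂ (# 32 * c) p₁) ⟩
      (1ℚ + ⟦ m ⟧ * (# 32 * c * p₁)) * (1ℚ - # 32 * c * p₁) ^ m  ≡⟨ *-comm (1ℚ + ⟦ m ⟧ * (# 32 * c * p₁)) _ ⟩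
      (1ℚ - # 32 * c * p₁) ^ m * (1ℚ + ⟦ m ⟧ * (# 32 * c * p₁))  ≤⟨ bernoulli-decay m (*-nonneg (#c 32) 0≤p₁)
                                                                     (*-mono (#c 32) 0≤1 32c≤1 p₁≤1) ⟩
      1ℚ                                            ∎
      where
      open ≤-Reasoning
      lem₁ : ∀ h m p → 1ℚ + h * (m * p) ≡ 1ℚ + m * (h * p)
      lem₁ = solve-∀ ℚ-ring
      lem₂ : ∀ h p → 1ℚ - p + p * (1ℚ - h) ≡ 1ℚ - h * p
      lem₂ = solve-∀ ℚ-ring

    κ : ℚ
    κ = # 8 * (c * c)

    0≤κ : 0ℚ ≤ κ
    0≤κ = *-nonneg (#-nonneg 8) 0≤c²

    -- Shared by both rounds, each of which gains a factor `1 + κ` per vertex. The 2 absorbs the two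
    -- colours of the root in the second round.
    growth : ∀ s → 8 ℕ.* r ℕ.≤ s → # 2 ≤ δ * (1ℚ + κ) ^ s
    growth s 8r≤s = ≤-trans large-r (*-monoʳ 0≤δ (≤-trans (*-monoˡ 0≤κ (⟦⟧-mono 8r≤s))
      (≤-trans (≤-by 1ℚ 0≤1 (+-comm (⟦ s ⟧ * κ) 1ℚ)) (bernoulli s 0≤κ))))

    -- With no more vertices found than explored, every factor `z` pairs with a `γ`, and `z * γ`
    -- exceeds `1 + κ`.
    stuck : ∀ found done → found ℕ.≤ done → 8 ℕ.* r ℕ.≤ done → 1ℚ ≤ δ * (z ^ found * γ ^ done)
    stuck found done found≤ 8r≤ = begin
      1ℚ                            ≤⟨ ≤-by 1ℚ 0≤1 refl ⟩
      # 2                           ≤⟨ growth done 8r≤ ⟩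
      δ * (1ℚ + κ) ^ done           ≤⟨ *-monoʳ 0≤δ (^-monoˡ done (+-nonneg 0≤1 0≤κ) (explored-growth μ≥)) ⟩
      δ * (z * γ) ^ done            ≡⟨ cong (_*_ δ) (^-distrib-* z γ done) ⟩
      δ * (z ^ done * γ ^ done)     ≤⟨ *-monoʳ 0≤δ (*-monoˡ (^-nonneg done 0≤γ) (^-antiʳ 0≤z z≤1 found≤)) ⟩
      δ * (z ^ found * γ ^ done)    ∎
      where open ≤-Reasoning

    -- Second round: the sprinkled edges.

    u y a b : ℚ
    u = 1ℚ + c * c
    y = c * c
    a = 1ℚ - # 32 * c * ι
    b = 1ℚ + # 64 * (c * c * c) * ι

    1≤u : 1ℚ ≤ u
    1≤u = ≤-by (c * c) 0≤c² refl

    0≤32cι : 0ℚ ≤ # 32 * c * ι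
    0≤32cι = *-nonneg (#c 32) 0≤ι

    32cι≤1 : # 32 * c * ι ≤ 1ℚ
    32cι≤1 = *-mono (#c 32) 0≤1 32c≤1 ι≤1

    0≤64c³ι : 0ℚ ≤ # 64 * (c * c * c) * ι
    0≤64c³ι = *-nonneg (*-nonneg (#-nonneg 64) (*-nonneg 0≤c² 0≤c)) 0≤ι

    bichrom-factor : 1ℚ - p₂ + p₂ * u ≤ b
    bichrom-factor = ≤-reflexive (lem c ι)
      where
      lem : ∀ c ι → 1ℚ - # 64 * c * ι + # 64 * c * ι * (1ℚ + c * c) ≡ 1ℚ + # 64 * (c * c * c) * ι
      lem = solve-∀ ℚ-ring

    ℓ₀ : ℕ
    ℓ₀ = Q ℕ.* (Q ℕ.* Q)

    ℓ₀c³≡1 : ⟦ ℓ₀ ⟧ * (c * c) * c ≡ 1ℚ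
    ℓ₀c³≡1 = begin
      ⟦ ℓ₀ ⟧ * (c * c) * c                      ≡⟨ cong (λ a → a * (c * c) * c) (trans (⟦⟧-* Q (Q ℕ.* Q)) (cong (_*_ ⟦ Q ⟧) (⟦⟧-* Q Q))) ⟩
      ⟦ Q ⟧ * (⟦ Q ⟧ * ⟦ Q ⟧) * (c * c) * c     ≡⟨ lem ⟦ Q ⟧ c ⟩
      ⟦ Q ⟧ * c * (⟦ Q ⟧ * c) * (⟦ Q ⟧ * c)     ≡⟨ cong (λ a → a * a * a) Qc≡1 ⟩
      1ℚ * 1ℚ * 1ℚ                              ≡⟨⟩
      1ℚ                                        ∎
      where
      open ≡-Reasoning
      lem : ∀ Q c → Q * (Q * Q) * (c * c) * c ≡ Q * c * (Q * c) * (Q * c)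
      lem = solve-∀ ℚ-ring

    -- Bernoulli is applied to each half of the exponent: `u ^ ℓ₀ ≥ ℓ₀ c² = 1 / c`, and the square
    -- cancels `y = c²`. A single application to the whole power would need an exponent of order
    -- `c ^ -4`. This is the step that fixes `ℓ₀ = Q³`.
    uᵏy≥1 : 1ℚ ≤ u ^ (2 ℕ.* ℓ₀) * y
    uᵏy≥1 = begin
      1ℚ                          ≡⟨⟩
      1ℚ * 1ℚ                     ≡⟨ cong₂ _*_ ℓ₀c³≡1 ℓ₀c³≡1 ⟨
      s * c * (s * c)             ≡⟨ lem s c ⟩
      s * s * y                   ≤⟨ *-monoˡ 0≤c² (*-mono 0≤s (^-nonneg ℓ₀ (≤-trans 0≤1 1≤u)) s≤ s≤) ⟩
      u ^ ℓ₀ * u ^ ℓ₀ * y         ≡⟨ cong (_* y) (^-+ u ℓ₀ ℓ₀) ⟨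
      u ^ (ℓ₀ ℕ.+ ℓ₀) * y         ≡⟨ cong (λ k → u ^ (ℓ₀ ℕ.+ k) * y) (ℕₚ.+-identityʳ ℓ₀) ⟨
      u ^ (2 ℕ.* ℓ₀) * y          ∎
      where
      open ≤-Reasoning
      s = ⟦ ℓ₀ ⟧ * (c * c)
      0≤s = *-nonneg (⟦⟧-nonneg ℓ₀) 0≤c²
      s≤ : s ≤ u ^ ℓ₀
      s≤ = ≤-trans (≤-by 1ℚ 0≤1 (+-comm s 1ℚ)) (bernoulli ℓ₀ 0≤c²)
      lem : ∀ s c → s * c * (s * c) ≡ s * s * (c * c)
      lem = solve-∀ ℚ-ring

    perVertex : ℚ
    perVertex = a ^ r * b ^ (8 ℕ.* r)

    -- The exponent is `r * 32 c / n = 32 c x`, at least `16 c²` because `r / n ≥ c / 2`.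
    a-decay : a ^ r * (1ℚ + # 16 * (c * c)) ≤ 1ℚ
    a-decay = ≤-trans (*-monoʳ (^-nonneg r (gap 32cι≤1)) (+-monoʳ-≤ 1ℚ (begin
      # 16 * (c * c)               ≡⟨ lem₁ c ⟩
      # 16 * c * c                 ≤⟨ *-monoʳ (#c 16) c≤2x ⟩
      # 16 * c * (x + x)           ≡⟨ lem₂ c ⟦ r ⟧ ι ⟩
      ⟦ r ⟧ * (# 32 * c * ι)       ∎))) (bernoulli-decay r 0≤32cι 32cι≤1)
      where
      open ≤-Reasoning
      lem₁ : ∀ c → # 16 * (c * c) ≡ # 16 * c * c
      lem₁ = solve-∀ ℚ-ring
      lem₂ : ∀ c r ι → # 16 * c * (r * ι + r * ι) ≡ r * (# 32 * c * ι)
      lem₂ = solve-∀ ℚ-ring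

    1≤b : 1ℚ ≤ b
    1≤b = ≤-by _ 0≤64c³ι refl

    -- The exponent is `8 r * 64 c³ / n = 512 c³ x`, at most `512 c⁴`: charging `u` on all sprinkled
    -- edges inside the tree costs only a higher order term.
    b-growth : b ^ (8 ℕ.* r) * (1ℚ - # 512 * (c * c * (c * c))) ≤ 1ℚ
    b-growth = ≤-trans (*-monoʳ (^-nonneg (8 ℕ.* r) (≤-trans 0≤1 1≤b)) (+-monoʳ-≤ 1ℚ (neg-antimono-≤ (begin
      ⟦ 8 ℕ.* r ⟧ * (# 64 * (c * c * c) * ι)      ≡⟨ cong (_* (# 64 * (c * c * c) * ι)) (trans (⟦⟧-* 8 r) (cong (_* ⟦ r ⟧) (sym (/1≡⟦⟧ 8)))) ⟩
      # 8 * ⟦ r ⟧ * (# 64 * (c * c * c) * ι)      ≡⟨ lem₁ c ⟦ r ⟧ ι ⟩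
      # 512 * (c * c * c) * x                     ≤⟨ *-monoʳ (*-nonneg (#-nonneg 512) (*-nonneg 0≤c² 0≤c)) x≤c ⟩
      # 512 * (c * c * c) * c                     ≡⟨ lem₂ c ⟩
      # 512 * (c * c * (c * c))                   ∎)))) (bernoulli-growth (8 ℕ.* r) 0≤64c³ι)
      where
      open ≤-Reasoning
      lem₁ : ∀ c r ι → # 8 * r * (# 64 * (c * c * c) * ι) ≡ # 512 * (c * c * c) * (r * ι)
      lem₁ = solve-∀ ℚ-ring
      lem₂ : ∀ c → # 512 * (c * c * c) * c ≡ # 512 * (c * c * (c * c))
      lem₂ = solve-∀ ℚ-ring

    0≤perVertex : 0ℚ ≤ perVertex
    0≤perVertex = *-nonneg (^-nonneg r (gap 32cι≤1)) (^-nonneg (8 ℕ.* r) (≤-trans 0≤1 1≤b))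

    ρ : ℚ
    ρ = u * (1ℚ + y) * perVertex

    0≤ρ : 0ℚ ≤ ρ
    0≤ρ = *-nonneg (*-nonneg (≤-trans 0≤1 1≤u) (≤-trans 0≤1 1≤u)) 0≤perVertex

    -- `ρ` is the total price of one tree vertex: the compensation `u`, the choice `1 + y`, and the
    -- sprinkling.
    ρ-decay : ρ * (1ℚ + κ) ≤ 1ℚ
    ρ-decay = begin
      u * u * perVertex * (1ℚ + κ)                       ≡⟨ lem₁ (u * u) perVertex (1ℚ + κ) ⟩
      perVertex * (u * u * (1ℚ + κ))                     ≤⟨ *-monoʳ 0≤perVertex balance ⟩
      perVertex * ((1ℚ + # 16 * y) * (1ℚ - # 512 * (y * y)))
        ≡⟨ lem₂ (a ^ r) (b ^ (8 ℕ.* r)) (1ℚ + # 16 * y) (1ℚ - # 512 * (y * y)) ⟩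
      a ^ r * (1ℚ + # 16 * y) * (b ^ (8 ℕ.* r) * (1ℚ - # 512 * (y * y)))
        ≤⟨ *-mono (*-nonneg (^-nonneg r (gap 32cι≤1)) (+-nonneg 0≤1 (*-nonneg (#-nonneg 16) 0≤c²))) 0≤1 a-decay b-growth ⟩
      1ℚ ∎
      where
      open ≤-Reasoning
      lem₁ : ∀ a b c → a * b * c ≡ b * (a * c)
      lem₁ = solve-∀ ℚ-ring
      lem₂ : ∀ a b c d → a * b * (c * d) ≡ a * c * (b * d)
      lem₂ = solve-∀ ℚ-ring

    ρ-power : ∀ s → 8 ℕ.* r ℕ.≤ s → (1ℚ + 1ℚ) * ρ ^ s ≤ δ
    ρ-power s 8r≤s = begin
      # 2 * ρ ^ s                      ≤⟨ *-monoˡ (^-nonneg s 0≤ρ) (growth s 8r≤s) ⟩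
      δ * (1ℚ + κ) ^ s * ρ ^ s         ≡⟨ lem δ ((1ℚ + κ) ^ s) (ρ ^ s) ⟩
      δ * (ρ ^ s * (1ℚ + κ) ^ s)       ≡⟨ cong (_*_ δ) (^-distrib-* ρ (1ℚ + κ) s) ⟨
      δ * (ρ * (1ℚ + κ)) ^ s           ≤⟨ *-monoʳ 0≤δ (^-≤1 s (*-nonneg 0≤ρ (+-nonneg 0≤1 0≤κ)) ρ-decay) ⟩
      δ * 1ℚ                           ≡⟨ *-identityʳ δ ⟩
      δ                                ∎
      where
      open ≤-Reasoning
      lem : ∀ a b c → a * b * c ≡ a * (c * b)
      lem = solve-∀ ℚ-ring

    -- One `δ` pays for an exploration that gets stuck, the other for colourings of the tree that
    -- survive the sprinkling.
    Prob-separable : ∀ k → suc k ≡ 2 ℕ.* ℓ₀ → Prob n (pGnp n ε) (separable (suc k) n) ≤ δ + δ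
    Prob-separable k k≡ = begin
      Prob n p (separable (suc k) n)             ≡⟨ Prob≡E n p (separable (suc k) n) ⟩
      E p (λ G → indicator (separable (suc k) n G)) ≡⟨ E-∨ {p} {p₁} {p₂} two-rounds (λ G → indicator (separable (suc k) n G)) ⟩
      E p₁ f                                     ≤⟨ Exploration.E≤ {n} f {p₁} {z} {γ} {δ} {δ} 0≤p₁ p₁≤1 0≤z z≤1 0≤γ 0≤δ r 1≤r 16r≤n γ-step f≤1 f-tree 0≤δ stuck ⟩
      δ + δ                                      ∎
      where
      open ≤-Reasoning
      f : Graph n → ℚ
      f G = E p₂ (λ H → indicator (separable (suc k) n (zipWith _∨_ G H)))
      indicator≤1 : ∀ b → indicator b ≤ 1ℚ
      indicator≤1 b = indicator-≤ b 0≤1 (λ _ → ≤-refl)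
      f≤1 : ∀ G → f G ≤ 1ℚ
      f≤1 G = subst (f G ≤_) (E-const p₂ (numPairs n) 1ℚ)
        (E-mono 0≤p₂ p₂≤1 (λ H → indicator≤1 (separable (suc k) n (zipWith _∨_ G H))))
      f-tree : ∀ G {xs} → Tree (λ u v → Joined {n} u v G) xs → 8 ℕ.* r ℕ.≤ length xs → length xs ℕ.≤ 16 ℕ.* r → f G ≤ δ
      f-tree G {xs} T 8r≤ ≤16r = ≤-trans
        (Certificate.separable-unlikely {n} G T {u} {y} 1≤u 0≤c² {p₂} {a} {b} 0≤p₂ p₂≤1
          (≤-by (# 32 * c * ι) 0≤32cι (lem (# 32 * c * ι))) 1≤b (mono-factor 0≤ι) bichrom-factor r 1≤r 8r≤ ≤16r
          {k} (subst (λ k → 1ℚ ≤ u ^ k * y) (sym k≡) uᵏy≥1))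
        (ρ-power (length xs) 8r≤)
        where
        lem : ∀ a → 1ℚ - a + a ≡ 1ℚ
        lem = solve-∀ ℚ-ring

  -- Choice of the constants and the threshold

  *-pos : ∀ {p q} → 0ℚ < p → 0ℚ < q → 0ℚ < p * q
  *-pos {p} {q} 0<p 0<q = subst (_< p * q) (*-zeroʳ p) (*-monoʳ-<-pos p {{ℚ.positive 0<p}} 0<q)

  -- For `r` the quotient rounded down, the remainder is below `Q`, and `Q ≤ r Q` because `r` is at
  -- least 1.
  quotient-bounds : ∀ Q {r₀} n → 1 ℕ.≤ Q → 1 ℕ.≤ r₀ → Q ℕ.* r₀ ℕ.≤ n →
    ∃ λ r → r₀ ℕ.≤ r × Q ℕ.* r ℕ.≤ n × n ℕ.≤ Q ℕ.* (r ℕ.+ r)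
  quotient-bounds Q@(suc _) {r₀} n 1≤Q 1≤r₀ Qr₀≤n = r , r₀≤r , Qr≤n , n≤
    where
    r = n DivMod./ Q
    Qr≤n : Q ℕ.* r ℕ.≤ n
    Qr≤n = ℕₚ.≤-trans (ℕₚ.≤-reflexive (ℕₚ.*-comm Q r)) (DivMod.m/n*n≤m n Q)
    n≡ : n ≡ n DivMod.% Q ℕ.+ r ℕ.* Q
    n≡ = DivMod.m≡m%n+[m/n]*n n Q
    r₀≤r : r₀ ℕ.≤ r
    r₀≤r = subst (ℕ._≤ r) (trans (cong (DivMod._/ Q) (ℕₚ.*-comm Q r₀)) (DivMod.m*n/n≡m r₀ Q)) (DivMod./-monoˡ-≤ Q Qr₀≤n)
    n≤ : n ℕ.≤ Q ℕ.* (r ℕ.+ r)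
    n≤ = begin
      n                            ≡⟨ n≡ ⟩
      n DivMod.% Q ℕ.+ r ℕ.* Q     ≤⟨ ℕₚ.+-monoˡ-≤ (r ℕ.* Q) (ℕₚ.<⇒≤ (DivMod.m%n<n n Q)) ⟩
      Q ℕ.+ r ℕ.* Q                ≤⟨ ℕₚ.+-monoˡ-≤ (r ℕ.* Q) (ℕₚ.m≤n*m Q r {{ℕ.>-nonZero (ℕₚ.≤-trans 1≤r₀ r₀≤r)}}) ⟩
      r ℕ.* Q ℕ.+ r ℕ.* Q          ≡⟨ ℕₚ.*-distribʳ-+ Q r r ⟨
      (r ℕ.+ r) ℕ.* Q              ≡⟨ ℕₚ.*-comm (r ℕ.+ r) Q ⟩
      Q ℕ.* (r ℕ.+ r)              ∎
      where open ℕₚ.≤-Reasoning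

  whp-no-hom : ∀ {ε c} Q → 0ℚ < ε → 0ℚ < c → 256 ℕ.≤ Q → ⟦ Q ⟧ * c ≡ 1ℚ → # 256 * c ≤ ε → WHPNoHom ε (Q ℕ.* (Q ℕ.* Q))
  -- The summand `B` ensures `1 + ε ≤ n`, so that the edge probability is at most 1; `Q * r₀`
  -- ensures that `n / Q` rounded down is at least `r₀`.
  whp-no-hom {ε} {c} Q 0<ε 0<c 256≤Q Qc≡1 256c≤ε δ 0<δ = suc (B ℕ.+ Q ℕ.* r₀) , λ where
      zero     ()
      (suc n′) N≤n →
        separable (suc k) (suc n′) ,
        (λ G (ℓ , ℓ₀≤ℓ , hom) → Separated⇒separable {σ = cutFamily (suc k) (proj₁ hom)} {G}
          (HomToCycle⇒Separated {k = suc k} {ℓ} {G} (ℕₚ.≤-trans (ℕₚ.≤-reflexive k≡) (ℕₚ.*-monoʳ-≤ 2 ℓ₀≤ℓ)) hom)) ,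
        ≤-<-trans (bound n′ N≤n) (subst (_< δ) (lem₁ (proj₁ mid)) (proj₂ (proj₂ mid)))
    where
    ℓ₀ = Q ℕ.* (Q ℕ.* Q)
    1≤Q : 1 ℕ.≤ Q
    1≤Q = ℕₚ.≤-trans (s≤s z≤n) 256≤Q
    1≤2ℓ₀ : 1 ℕ.≤ 2 ℕ.* ℓ₀
    1≤2ℓ₀ = ℕₚ.*-mono-≤ {1} {2} {1} {ℓ₀} (s≤s z≤n) (ℕₚ.*-mono-≤ 1≤Q (ℕₚ.*-mono-≤ 1≤Q 1≤Q))
    k = ℕ.pred (2 ℕ.* ℓ₀)
    k≡ : suc k ≡ 2 ℕ.* ℓ₀
    k≡ = ℕₚ.suc-pred (2 ℕ.* ℓ₀) {{ℕ.>-nonZero 1≤2ℓ₀}}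
    -- The estimate gives `δ′ + δ′` with a weak inequality; a point strictly between 0 and `δ` makes
    -- the conclusion strict.
    mid = <-dense 0<δ
    δ′ = ℚ.½ * proj₁ mid
    0<δ′ : 0ℚ < δ′
    0<δ′ = *-pos (positive⁻¹ ℚ.½) (proj₁ (proj₂ mid))
    lem₁ : ∀ d → d ≡ ℚ.½ * d + ℚ.½ * d
    lem₁ = solve-∀ ℚ-ring
    size-bound = ≤⟦⟧ (1ℚ + ε) (<-≤-trans 0<1 (≤-by ε (<⇒≤ 0<ε) refl))
    B = proj₁ size-bound
    large = archimedean-≥ (δ′ * (# 64 * (c * c))) 2 (*-pos 0<δ′ (*-pos (positive⁻¹ (# 64)) (*-pos 0<c 0<c)))
    r₀ = suc (proj₁ large)
    256c≤1 : # 256 * c ≤ 1ℚ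
    256c≤1 = subst₂ _≤_ (cong (_* c) (sym (/1≡⟦⟧ 256))) Qc≡1 (*-monoˡ (<⇒≤ 0<c) (⟦⟧-mono 256≤Q))
    lem₂ : ∀ r d w → r * (d * (# 64 * w)) ≡ d * (# 8 * r * (# 8 * w))
    lem₂ = solve-∀ ℚ-ring
    large-r : ∀ r → r₀ ℕ.≤ r → # 2 ≤ δ′ * (⟦ 8 ℕ.* r ⟧ * (# 8 * (c * c)))
    large-r r r₀≤r = begin
      # 2                                          ≡⟨ /1≡⟦⟧ 2 ⟩
      ⟦ 2 ⟧                                        ≤⟨ proj₂ large ⟩
      ⟦ proj₁ large ⟧ * (δ′ * (# 64 * (c * c)))
        ≤⟨ *-monoˡ (*-nonneg (<⇒≤ 0<δ′) (*-nonneg (#-nonneg 64) (*-nonneg (<⇒≤ 0<c) (<⇒≤ 0<c)))) (⟦⟧-mono (ℕₚ.<⇒≤ r₀≤r)) ⟩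
      ⟦ r ⟧ * (δ′ * (# 64 * (c * c)))              ≡⟨ lem₂ ⟦ r ⟧ δ′ (c * c) ⟩
      δ′ * (# 8 * ⟦ r ⟧ * (# 8 * (c * c)))         ≡⟨ cong (λ a → δ′ * (a * ⟦ r ⟧ * (# 8 * (c * c)))) (/1≡⟦⟧ 8) ⟩
      δ′ * (⟦ 8 ⟧ * ⟦ r ⟧ * (# 8 * (c * c)))       ≡⟨ cong (λ a → δ′ * (a * (# 8 * (c * c)))) (⟦⟧-* 8 r) ⟨
      δ′ * (⟦ 8 ℕ.* r ⟧ * (# 8 * (c * c)))         ∎
      where open ≤-Reasoning
    bound : ∀ n′ → suc (B ℕ.+ Q ℕ.* r₀) ℕ.≤ suc n′ → Prob (suc n′) (pGnp (suc n′) ε) (separable (suc k) (suc n′)) ≤ δ′ + δ′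
    bound n′ N≤n =
      let r , r₀≤r , Qr≤n , n≤2Qr = quotient-bounds Q {r₀} (suc n′) 1≤Q (s≤s z≤n) (ℕₚ.≤-trans (ℕₚ.m≤n+m (Q ℕ.* r₀) (suc B)) N≤n)
      in Sprinkling.Prob-separable {ε} {c} {Q} {n′} {r} (<⇒≤ 0<c) 256c≤1 256c≤ε Qc≡1
           (ℕₚ.≤-trans (s≤s z≤n) r₀≤r) Qr≤n n≤2Qr
           (ℕₚ.≤-trans (ℕₚ.*-monoˡ-≤ r (ℕₚ.≤-trans (ℕₚ.m≤m+n 16 240) 256≤Q)) Qr≤n)
           (≤-trans (proj₂ size-bound) (⟦⟧-mono (ℕₚ.≤-trans (ℕₚ.m≤n⇒m≤1+n (ℕₚ.m≤m+n B (Q ℕ.* r₀))) N≤n)))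
           {δ′} (<⇒≤ 0<δ′) (large-r r r₀≤r) k k≡

  -- For `ε ≤ 1` the product of `Q = 256 (q + 1)` and ε is `256 (ε + q ε)`, at most 512, and the
  -- threshold is `Q³`.
  cubeConstant : ℕ
  cubeConstant = 512 ℕ.* (512 ℕ.* 512)

  Threshold : ℚ → Set
  Threshold ε = Σ ℕ λ ℓ₀ → (1 ℕ.≤ ℓ₀) × (ε ≤ 1ℚ → (+ ℓ₀ / 1) * (ε * (ε * ε)) ≤ + cubeConstant / 1) × WHPNoHom ε ℓ₀

  -- `Q` is a variable tied down by an equation, which keeps the multiple of 256 from unfolding in
  -- the types below. The scale is `c = 1 / Q`, and `(q + 1) ε ≥ 1` is what gives `256 c ≤ ε`.
  threshold-from : ∀ {ε} → 0ℚ < ε → ∀ q → 1ℚ ≤ ⟦ suc q ⟧ * ε → ⟦ q ⟧ * ε ≤ 1ℚ → ∀ Q → Q ≡ 256 ℕ.* suc q → Threshold ε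
  threshold-from {ε} 0<ε q 1≤qε qε≤1 Q Q≡ = ℓ₀ , ℕₚ.*-mono-≤ 1≤Q (ℕₚ.*-mono-≤ 1≤Q 1≤Q) , small ,
      whp-no-hom Q 0<ε 0<c 256≤Q Qc≡1 256c≤ε
    where
    ℓ₀ = Q ℕ.* (Q ℕ.* Q)
    256≤Q : 256 ℕ.≤ Q
    256≤Q = subst (256 ℕ.≤_) (sym Q≡) (ℕₚ.*-monoʳ-≤ 256 {1} {suc q} (s≤s z≤n))
    1≤Q : 1 ℕ.≤ Q
    1≤Q = ℕₚ.≤-trans (s≤s z≤n) 256≤Q
    recip = reciprocal {⟦ Q ⟧} (<-≤-trans 0<1 (⟦⟧-mono 1≤Q))
    c = proj₁ recip
    0<c = proj₁ (proj₂ recip)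
    Qc≡1 = proj₂ (proj₂ recip)
    Q≡256q : ⟦ Q ⟧ ≡ # 256 * ⟦ suc q ⟧
    Q≡256q = trans (cong ⟦_⟧ Q≡) (trans (⟦⟧-* 256 (suc q)) (cong (_* ⟦ suc q ⟧) (sym (/1≡⟦⟧ 256))))
    256c≤ε : # 256 * c ≤ ε
    256c≤ε = begin
      # 256 * c                         ≡⟨ *-identityʳ (# 256 * c) ⟨
      # 256 * c * 1ℚ                    ≤⟨ *-monoʳ (*-nonneg (#-nonneg 256) (<⇒≤ 0<c)) 1≤qε ⟩
      # 256 * c * (⟦ suc q ⟧ * ε)       ≡⟨ lem c ⟦ suc q ⟧ ε ⟩
      # 256 * ⟦ suc q ⟧ * c * ε         ≡⟨ cong (λ a → a * c * ε) Q≡256q ⟨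
      ⟦ Q ⟧ * c * ε                     ≡⟨ cong (_* ε) Qc≡1 ⟩
      1ℚ * ε                            ≡⟨ *-identityˡ ε ⟩
      ε                                 ∎
      where
      open ≤-Reasoning
      lem : ∀ c q ε → # 256 * c * (q * ε) ≡ # 256 * q * c * ε
      lem = solve-∀ ℚ-ring
    small : ε ≤ 1ℚ → (+ ℓ₀ / 1) * (ε * (ε * ε)) ≤ + (512 ℕ.* (512 ℕ.* 512)) / 1
    small ε≤1 = begin
      # ℓ₀ * (ε * (ε * ε))                              ≡⟨ cong (_* (ε * (ε * ε))) (/1≡⟦⟧ ℓ₀) ⟩
      ⟦ ℓ₀ ⟧ * (ε * (ε * ε))                            ≡⟨ cong (_* (ε * (ε * ε))) (cube Q) ⟩
      ⟦ Q ⟧ * (⟦ Q ⟧ * ⟦ Q ⟧) * (ε * (ε * ε))           ≡⟨ lem₁ ⟦ Q ⟧ ε ⟩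
      ⟦ Q ⟧ * ε * (⟦ Q ⟧ * ε * (⟦ Q ⟧ * ε))             ≤⟨ *-mono 0≤Qε (*-nonneg (#-nonneg 512) (#-nonneg 512)) Qε≤512
                                                            (*-mono 0≤Qε (#-nonneg 512) Qε≤512 Qε≤512) ⟩
      # 512 * (# 512 * # 512)                           ≡⟨ cong (λ a → a * (a * a)) (/1≡⟦⟧ 512) ⟩
      ⟦ 512 ⟧ * (⟦ 512 ⟧ * ⟦ 512 ⟧)                     ≡⟨ cube 512 ⟨
      ⟦ 512 ℕ.* (512 ℕ.* 512) ⟧                         ≡⟨ /1≡⟦⟧ (512 ℕ.* (512 ℕ.* 512)) ⟨
      # (512 ℕ.* (512 ℕ.* 512))                         ∎
      where
      open ≤-Reasoning
      cube : ∀ m → ⟦ m ℕ.* (m ℕ.* m) ⟧ ≡ ⟦ m ⟧ * (⟦ m ⟧ * ⟦ m ⟧)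
      cube m = trans (⟦⟧-* m (m ℕ.* m)) (cong (_*_ ⟦ m ⟧) (⟦⟧-* m m))
      lem₁ : ∀ Q ε → Q * (Q * Q) * (ε * (ε * ε)) ≡ Q * ε * (Q * ε * (Q * ε))
      lem₁ = solve-∀ ℚ-ring
      lem₂ : ∀ q ε → # 256 * (1ℚ + q) * ε ≡ # 256 * (ε + q * ε)
      lem₂ = solve-∀ ℚ-ring
      0≤Qε : 0ℚ ≤ ⟦ Q ⟧ * ε
      0≤Qε = *-nonneg (⟦⟧-nonneg Q) (<⇒≤ 0<ε)
      Qε≤512 : ⟦ Q ⟧ * ε ≤ # 512
      Qε≤512 = begin
        ⟦ Q ⟧ * ε                    ≡⟨ cong (_* ε) Q≡256q ⟩
        # 256 * ⟦ suc q ⟧ * ε        ≡⟨ lem₂ ⟦ q ⟧ ε ⟩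
        # 256 * (ε + ⟦ q ⟧ * ε)      ≤⟨ *-monoʳ (#-nonneg 256) (+-mono-≤ ε≤1 qε≤1) ⟩
        # 256 * (1ℚ + 1ℚ)            ≡⟨⟩
        # 512                        ∎

  threshold : ∀ ε → 0ℚ < ε → Threshold ε
  threshold ε 0<ε =
    let K , 1≤Kε = archimedean ε 0<ε
        q , 1≤qε , qε≤1 = least-multiple ε K 1≤Kε
    in threshold-from 0<ε q 1≤qε qε≤1 (256 ℕ.* suc q) refl

open import Data.Nat using (ℕ; _≤_)
open import Data.Rational using (ℚ; 0ℚ; 1ℚ; _<_; _*_; _/_)
open import Data.Integer using (+_)
open import Data.Product using (Σ; _×_)

theorem1p4 : Σ ℕ λ C → ∀ (ε : ℚ) → 0ℚ < ε →
    Σ ℕ λ ℓ₀ → (1 ≤ ℓ₀)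
    × (ε Data.Rational.≤ 1ℚ → ((+ ℓ₀ / 1) * (ε * (ε * ε))) Data.Rational.≤ (+ C / 1))
    × WHPNoHom ε ℓ₀
theorem1p4 = Development.cubeConstant , Development.threshold
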